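{- The Hamiltonians Poisson-commute: $\{H_m,H_n\}=0$ for all $m,n\in[1,r]$.
   Context: Fix $r\ge1$; let $C$ be the Cartan matrix of type $A_r$. On Laurent polynomials in $A_1,\dots,A_{2r}$ define the Poisson bracket $\{A_i,A_j\}=\Omega_{ij}A_iA_j$ (bilinear, Leibniz), with $\Omega=\begin{bmatrix}0&C^{ -1}\\-C^{ -1}&0\end{bmatrix}$ in $r\times r$ blocks. Let $\mathbb{T}=\mathbb{R}^2/(2\mathbb{Z}\times(r+1)\mathbb{Z})$ and let $G$ be the bipartite graph embedded in $\mathbb{T}$ with vertices $(x,y)$, $x\in\{0,1\}$ (mod 2), $y\in\{0,\dots,r\}$, $(x,y)$ black iff $x+y$ odd; edges: for each $y\in\{0,\dots,r\}$ the horizontal segments $[0,1]\times\{y\}$ and $[1,2]\times\{y\}$, and for each $y\in\{0,\dots,r-1\}$, $x\in\{0,1\}$ the vertical segment $\{x\}\times[y,y+1]$. Faces: the annulus $(\mathbb{R}/2\mathbb{Z})\times(r,r+1)$ is labeled $0$; for $a\in[1,r]$ odd, $(0,1)\times(a-1,a)$ is labeled $a$ and $(1,2)\times(a-1,a)$ is labeled $r+a$; for $a$ even, $(1,2)\times(a-1,a)$ is labeled $a$ and $(0,1)\times(a-1,a)$ is labeled $r+a$. Face $0$ has weight $1$, face $i\in[1,2r]$ has weight $A_i$. For a perfect matching $M$, $w(M)=\prod_{e\in M}(A_iA_j)^{ -1}$ with $i,j$ the faces on either side of $e$. $M_0$ is the perfect matching consisting, for each $y$, of the horizontal edge at height $y$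 whose left endpoint ($(0,y)$ for $[0,1]\times\{y\}$, $(1,y)$ for $[1,2]\times\{y\}$) is black. For a perfect matching $M$, orient edges of $M$ black$\to$white and of $M_0$ white$\to$black, discard common edges, and let $[M]_{M_0}\in H_1(\mathbb{T},\mathbb{Z})$ be the class of the resulting oriented loops. With $\eta$ the class of a horizontal loop traversed once in the direction of decreasing $x$, $H_k:=\sum_{M:[M]_{M_0}=k\eta}w(M)/w(M_0)$, a Laurent polynomial in $A_1,\dots,A_{2r}$. -}

module Defs where

open import Data.Bool using (Bool; true; false; if_then_else_; _∧_; not)
open import Data.Nat as ℕ using (ℕ; zero; suc; _∸_; _<?_; _≡ᵇ_)
open import Data.Integer as ℤ using (ℤ; +_; -[1+_])
open import Data.Rational as ℚ using (ℚ; 0ℚ; 1ℚ; _/_)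
open import Data.Fin as Fin using (Fin; toℕ; fromℕ<; _↑ˡ_; _↑ʳ_; splitAt)
open import Data.Fin.Properties as FinP using ()
open import Data.Vec as Vec using (Vec; tabulate; lookup; zipWith; replicate)
open import Data.Vec.Properties using (≡-dec)
open import Data.List as List using (List; []; _∷_; _++_; map; concatMap; foldr; filter; allFin)
open import Data.Bool.ListAction using (and; any)
open import Data.Maybe using (Maybe; just; nothing)
open import Data.Product using (_×_; _,_)
open import Data.Sum using (inj₁; inj₂)
open import Relation.Nullary using (yes; no; does)
open import Relation.Binary.PropositionalEquality using (_≡_)

-- Laurent polynomials over ℚ in n variables A_1..A_n (variable A_{i+1}
-- is indexed by i : Fin n).  A polynomial is a finite formal sum of
-- terms  c · A^e  (c ∈ ℚ, e ∈ ℤ^n), represented as a list of terms.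
-- Two representations denote the same Laurent polynomial iff all
-- collected coefficients agree.

Exps : ℕ → Set
Exps n = Vec ℤ n

Poly : ℕ → Set
Poly n = List (ℚ × Exps n)

coeff : ∀ {n} → Poly n → Exps n → ℚ
coeff [] e = 0ℚ
coeff ((c , e') ∷ p) e with ≡-dec ℤ._≟_ e' e
... | yes _ = c ℚ.+ coeff p e
... | no  _ = coeff p e

IsZero : ∀ {n} → Poly n → Set
IsZero p = ∀ e → coeff p e ≡ 0ℚ

scale : ∀ {n} → ℚ → Poly n → Poly n
scale s = map (λ { (c , e) → (s ℚ.* c , e) })

mul : ∀ {n} → Poly n → Poly n → Poly n
mul p q = concatMap (λ { (c , e) → map (λ { (d , f) → (c ℚ.* d , zipWith ℤ._+_ e f) }) q }) p

-- Euler derivative  θ_i = A_i ∂/∂A_i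
θ : ∀ {n} → Fin n → Poly n → Poly n
θ i = map (λ { (c , e) → ((lookup e i / 1) ℚ.* c , e) })

-- The log-canonical Poisson bracket with matrix Ω: the unique bilinear
-- biderivation with {A_i,A_j} = Ω_ij A_i A_j, namely
--   {f,g} = Σ_{i,j} Ω_ij (A_i ∂_i f)(A_j ∂_j g).
bracket : ∀ {n} → (Fin n → Fin n → ℚ) → Poly n → Poly n → Poly n
bracket {n} Ω f g =
  concatMap (λ i → concatMap (λ j → scale (Ω i j) (mul (θ i f) (θ j g))) (allFin n)) (allFin n)

CartanA : (r : ℕ) → Fin r → Fin r → ℚ
CartanA r i j =
  if toℕ i ≡ᵇ toℕ j then + 2 / 1
  else if (suc (toℕ i) ≡ᵇ toℕ j) Data.Bool.∨ (suc (toℕ j) ≡ᵇ toℕ i) then -[1+ 0 ] / 1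
  else 0ℚ

matMul : ∀ {r} → (Fin r → Fin r → ℚ) → (Fin r → Fin r → ℚ) → Fin r → Fin r → ℚ
matMul {r} P Q i j = foldr ℚ._+_ 0ℚ (map (λ k → P i k ℚ.* Q k j) (allFin r))

identity : ∀ {r} → Fin r → Fin r → ℚ
identity i j = if toℕ i ≡ᵇ toℕ j then 1ℚ else 0ℚ

IsCartanInverse : (r : ℕ) → (Fin r → Fin r → ℚ) → Set
IsCartanInverse r X =
  (∀ i j → matMul (CartanA r) X i j ≡ identity i j) ×
  (∀ i j → matMul X (CartanA r) i j ≡ identity i j)

Omega : (r : ℕ) → (Fin r → Fin r → ℚ) → Fin (r ℕ.+ r) → Fin (r ℕ.+ r) → ℚ
Omega r X i j with splitAt r i | splitAt r j
... | inj₁ a | inj₂ b = X a b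
... | inj₂ a | inj₁ b = ℚ.- X a b
... | _      | _      = 0ℚ

-- The bipartite graph G on the torus ℝ²/(2ℤ × (r+1)ℤ)

odd : ℕ → Bool
odd zero = false
odd (suc n) = not (odd n)

Vertex : ℕ → Set
Vertex r = Fin 2 × Fin (suc r)

black : ∀ {r} → Vertex r → Bool
black (x , y) = odd (toℕ x ℕ.+ toℕ y)

flip : Fin 2 → Fin 2
flip Fin.zero = Fin.suc Fin.zero
flip (Fin.suc _) = Fin.zero

data Edge (r : ℕ) : Set where
  -- hor c y : the segment [c, c+1] × {y}; left endpoint (c,y), right endpoint (c+1 mod 2, y)
  hor : Fin 2 → Fin (suc r) → Edge r
  -- ver x y : the segment {x} × [y, y+1]
  ver : Fin 2 → Fin r → Edge r

edgeEq : ∀ {r} → Edge r → Edge r → Bool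
edgeEq (hor c y) (hor c' y') = does (c Fin.≟ c') ∧ does (y Fin.≟ y')
edgeEq (ver x y) (ver x' y') = does (x Fin.≟ x') ∧ does (y Fin.≟ y')
edgeEq _ _ = false

allEdges : (r : ℕ) → List (Edge r)
allEdges r =
  concatMap (λ c → map (hor c) (allFin (suc r))) (allFin 2) ++
  concatMap (λ x → map (ver x) (allFin r)) (allFin 2)

vEq : ∀ {r} → Vertex r → Vertex r → Bool
vEq (x , y) (x' , y') = does (x Fin.≟ x') ∧ does (toℕ y ℕ.≟ toℕ y')

incident : ∀ {r} → Vertex r → Edge r → Bool
incident v (hor c y) = vEq v (c , y) Data.Bool.∨ vEq v (flip c , y)
incident v (ver x y) = vEq v (x , Fin.inject₁ y) Data.Bool.∨ vEq v (x , Fin.suc y)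

allVertices : (r : ℕ) → List (Vertex r)
allVertices r = concatMap (λ x → map (x ,_) (allFin (suc r))) (allFin 2)

-- all sub-multisets (= subsets, allEdges has no repetitions) of a list
sublists : ∀ {A : Set} → List A → List (List A)
sublists [] = [] ∷ []
sublists (x ∷ xs) = map (x ∷_) (sublists xs) ++ sublists xs

count : ∀ {A : Set} → (A → Bool) → List A → ℕ
count P xs = List.length (filter (λ a → Data.Bool._≟_ (P a) true) xs)

isPerfectMatching : ∀ {r} → List (Edge r) → Bool
isPerfectMatching {r} M = and (map (λ v → count (incident v) M ≡ᵇ 1) (allVertices r))

perfectMatchings : (r : ℕ) → List (List (Edge r))
perfectMatchings r = filter (λ M → Data.Bool._≟_ (isPerfectMatching M) true) (sublists (allEdges r))

M₀ : (r : ℕ) → List (Edge r)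
M₀ r = filter (λ e → Data.Bool._≟_ (leftBlack e) true) (concatMap (λ c → map (hor c) (allFin (suc r))) (allFin 2))
  where
  leftBlack : Edge r → Bool
  leftBlack (hor c y) = black (c , y)
  leftBlack (ver _ _) = false

-- Faces.  Faces are `nothing` (face 0, weight 1) or `just i` with
-- i : Fin (r + r) standing for the face labelled i+1 (weight A_{i+1}).
-- The cell (c, c+1) × (a-1, a), a ∈ [1,r], is given by column c and row a-1.

cell : (r : ℕ) → Fin 2 → ℕ → Maybe (Fin (r ℕ.+ r))
cell r c a-1 with a-1 <? r
... | no _ = nothing     -- row a-1 = r is the annulus (r, r+1): face 0
... | yes p with odd (suc a-1) | c
...   | true  | Fin.zero    = just (fromℕ< p ↑ˡ r)   -- a odd, (0,1): label a
...   | true  | Fin.suc _   = just (r ↑ʳ fromℕ< p)   -- a odd, (1,2): label r+a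
...   | false | Fin.suc _   = just (fromℕ< p ↑ˡ r)   -- a even, (1,2): label a
...   | false | Fin.zero    = just (r ↑ʳ fromℕ< p)   -- a even, (0,1): label r+a

facesOf : ∀ {r} → Edge r → Maybe (Fin (r ℕ.+ r)) × Maybe (Fin (r ℕ.+ r))
facesOf {r} (hor c Fin.zero)    = (nothing , cell r c 0)        -- below y=0 is the annulus (face 0)
facesOf {r} (hor c (Fin.suc y)) = (cell r c (toℕ y) , cell r c (suc (toℕ y)))
facesOf {r} (ver x y)           = (cell r Fin.zero (toℕ y) , cell r (Fin.suc Fin.zero) (toℕ y))

faceExp : ∀ {r} → Maybe (Fin (r ℕ.+ r)) → Exps (r ℕ.+ r)
faceExp nothing  = replicate _ (+ 0)
faceExp (just i) = tabulate (λ j → if does (i Fin.≟ j) then + 1 else + 0)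

edgeExp : ∀ {r} → Edge r → Exps (r ℕ.+ r)
edgeExp {r} e with facesOf e
... | (f , g) = Vec.map ℤ.-_ (zipWith ℤ._+_ (faceExp {r} f) (faceExp {r} g))

sumExps : ∀ {n} → List (Exps n) → Exps n
sumExps = foldr (zipWith ℤ._+_) (replicate _ (+ 0))

relWeightExp : ∀ {r} → List (Edge r) → Exps (r ℕ.+ r)
relWeightExp {r} M = zipWith ℤ._-_ (sumExps (map edgeExp M)) (sumExps (map edgeExp (M₀ r)))

-- Homology class [M]_{M₀} ∈ H₁(𝕋,ℤ) ≅ ℤ², in the basis (η, ν) where η is
-- the horizontal loop traversed in the direction of decreasing x and ν
-- is the vertical loop {1/2} × ℝ/(r+1)ℤ traversed in increasing y.
-- The class of a 1-cycle γ is (γ · ν' , γ · η') computed by signed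
-- intersection numbers: its η-coordinate is the signed number of
-- crossings of the vertical line x = 1/2 in the direction of decreasing x,
-- and its ν-coordinate is the signed number of crossings of the
-- horizontal line y = r + 1/2 in the direction of increasing y.

-- crossings of x = 1/2 (counted positively when moving to decreasing x)
-- of an edge oriented black → white.  Only the edges [0,1] × {y} cross it.
crossX-bw : ∀ {r} → Edge r → ℤ
crossX-bw (hor Fin.zero y) = if black (Fin.zero , y) then -[1+ 0 ] else + 1
crossX-bw (hor (Fin.suc _) _) = + 0
crossX-bw (ver _ _) = + 0

-- crossings of y = r + 1/2 of an edge oriented black → white: none, since
-- every edge lies in ℝ × [0, r].
crossY-bw : ∀ {r} → Edge r → ℤ
crossY-bw _ = + 0

elem : ∀ {r} → Edge r → List (Edge r) → Bool
elem e = any (edgeEq e)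

sumℤ : List ℤ → ℤ
sumℤ = foldr ℤ._+_ (+ 0)

-- edges of M oriented black→white, edges of M₀ oriented white→black
-- (the negative of black→white), common edges discarded
classWith : ∀ {r} → (Edge r → ℤ) → List (Edge r) → ℤ
classWith {r} cr M =
  sumℤ (map cr (filter (λ e → Data.Bool._≟_ (elem e (M₀ r)) false) M)) ℤ.+
  ℤ.- sumℤ (map cr (filter (λ e → Data.Bool._≟_ (elem e M) false) (M₀ r)))

homClass : ∀ {r} → List (Edge r) → ℤ × ℤ
homClass M = (classWith crossX-bw M , classWith crossY-bw M)

hasClass : ∀ {r} → ℤ → List (Edge r) → Bool
hasClass k M with homClass M
... | (a , b) = does (a ℤ.≟ k) ∧ does (b ℤ.≟ + 0)

H : (r : ℕ) → ℤ → Poly (r ℕ.+ r)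
H r k = map (λ M → (1ℚ , relWeightExp M))
            (filter (λ M → Data.Bool._≟_ (hasClass k M) true) (perfectMatchings r))

{-# OPTIONS --safe #-}
-- A perfect matching of G is a tiling of the rows 0, ..., r by horizontal edges and pairs of parallel
-- vertical edges.  Record for each row y two bits start(y), stop(y): both are 0 for the edge of M₀, both are 1
-- for the other horizontal edge, and a pair of vertical edges has start 1 in its lower and stop 1 in its upper
-- row.  Then the homology class is the number of starts, and the exponent of A_a (of A_{r+a}) in the relative
-- weight is a first difference of start (of stop).  As C is a second difference, C⁻¹ applied to first
-- differences is the identity up to a constant, which cancels because start and stop have equal sums; so the
-- monomials of T and U have bracket  cross(T,U) = Σ_y stop_T(y) start_U(y) − start_T(y) stop_U(y).
--
-- Superpose T and U and cut them at the heights where neither has a pair of vertical edges.  A component with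
-- non-zero contribution to cross(T,U) contributes equally to the classes of T and U, and exchanging T and U
-- inside it keeps both classes and the product monomial while negating its contribution.  Hence
-- Σ cross(T,U) over the pairs with given classes and given product monomial vanishes.
module Submission where

-- The exchange inside a component is not carried out as a bijection. The sum is shown to vanish
-- against every function of the two classes and of the profile, that is, of the sums of starts and
-- of stops row by row: such functions are stable under stripping the bottom row, and the product
-- monomial depends on the profile only. The induction is delicate at heights crossed by a pair of
-- vertical edges of exactly one tiling. The next row may close this pair while the other tiling
-- opens one, so the pairs form a staggered chain that alternates between the tilings. Such a row
-- has crossing 1 and reverses the roles. Up to terms symmetric in the tilings this turns the sum S
-- of weighted crossings into N - S, where N is the plain sum of the weights, and N - S back into S.
-- So two symmetries are proved together: for S with one class shifted by the start of the open
-- pair, and for N - S without a shift, since the next start in the other tiling evens the shift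
-- out. On the graph, circumference two is decisive: both horizontal edges of a row join the same
-- two vertices, so from row 0 upwards the vertical edges of the two columns are forced to agree.

open import Defs
open import Algebra.Structures using (IsCommutativeMonoid)
open import Data.Bool using (Bool; true; false; if_then_else_; _∧_; _∨_; not)
import Data.Bool as Bool
open import Data.Bool.ListAction using (and)
import Data.Bool.Properties as Bool
open import Data.Empty using (⊥-elim)
open import Data.Fin using (Fin; zero; suc; toℕ; inject₁; fromℕ; fromℕ<; _↑ˡ_; _↑ʳ_; splitAt)
import Data.Fin as Fin
import Data.Fin.Properties as Fin
open import Data.Integer using (ℤ)
import Data.Integer as ℤ
import Data.Integer.Properties as ℤ
import Data.Integer.Solver as ℤSolver
open import Data.List using (List; []; _∷_; _++_; map; concatMap; foldr; filter; allFin; tabulate)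
open import Data.List.Membership.Propositional using (_∈_; _∉_)
open import Data.List.Membership.Propositional.Properties
  using (∈-map⁺; ∈-map⁻; ∈-++⁺ˡ; ∈-++⁺ʳ; ∈-++⁻; ∈-filter⁺; ∈-filter⁻; ∈-allFin)
open import Data.List.Membership.Propositional.Properties.WithK using (unique∧set⇒bag)
open import Data.List.Properties using (map-tabulate; filter-++; ++-identityʳ)
open import Data.List.Relation.Binary.BagAndSetEquality using (∼bag⇒↭)
open import Data.List.Relation.Binary.Disjoint.Propositional using (Disjoint)
open import Data.List.Relation.Binary.Permutation.Propositional using (_↭_)
import Data.List.Relation.Binary.Permutation.Propositional as ↭
open import Data.List.Relation.Unary.All as All using (All; []; _∷_)
open import Data.List.Relation.Unary.AllPairs using ([]; _∷_)
open import Data.List.Relation.Unary.Any using (here; there)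
open import Data.List.Relation.Unary.Unique.Propositional using (Unique)
import Data.List.Relation.Unary.Unique.Propositional.Properties as Unique
open import Data.Maybe using (just)
open import Data.Nat using (ℕ; zero; suc; _≤_; _≡ᵇ_; _<?_)
import Data.Nat as ℕ
import Data.Nat.Coprimality as Coprimality
import Data.Nat.Properties as ℕ
open import Data.Product using (_×_; _,_; proj₁; proj₂; ∃-syntax; Σ-syntax)
open import Data.Rational using (ℚ; 0ℚ; 1ℚ; mkℚ; _/_; _+_; _*_; -_; _-_)
import Data.Rational.Properties as ℚ
open import Data.Rational.Solver using (module +-*-Solver)
open import Data.Sum using (_⊎_; inj₁; inj₂; [_,_]′)
open import Data.Vec using (Vec; []; _∷_; zipWith; lookup)
import Data.Vec as Vec
import Data.Vec.Properties as Vec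
open import Data.Vec.Relation.Binary.Pointwise.Extensional using (ext; Pointwise-≡⇒≡)
open import Function using (_∘_; id; mk⇔)
open import Relation.Binary.Definitions using (DecidableEquality)
open import Relation.Binary.PropositionalEquality
  using (_≡_; _≢_; refl; cong; cong₂; sym; trans; subst; module ≡-Reasoning)
open import Relation.Nullary using (¬_; Dec; does; yes; no)
open import Relation.Nullary.Decidable using (dec-true; dec-false)

-- Finite sums

-- Generic in the monoid: it serves ℚ for coefficients, ℕ for vertex degrees, and ℤ for exponents
-- and crossings.
module Summation {A : Set} {_∙_ : A → A → A} {ε : A} (isCM : IsCommutativeMonoid _≡_ _∙_ ε) where
  open IsCommutativeMonoid isCM
    using (assoc; identityˡ; identityʳ) renaming (comm to ∙-comm)
  open ≡-Reasoning

  sum : {B : Set} → List B → (B → A) → A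
  sum xs f = foldr _∙_ ε (map f xs)

  interchange : ∀ w x y z → (w ∙ x) ∙ (y ∙ z) ≡ (w ∙ y) ∙ (x ∙ z)
  interchange w x y z = begin
    (w ∙ x) ∙ (y ∙ z) ≡⟨ assoc w x (y ∙ z) ⟩
    w ∙ (x ∙ (y ∙ z)) ≡⟨ cong (w ∙_) (assoc x y z) ⟨
    w ∙ ((x ∙ y) ∙ z) ≡⟨ cong (λ v → w ∙ (v ∙ z)) (∙-comm x y) ⟩
    w ∙ ((y ∙ x) ∙ z) ≡⟨ cong (w ∙_) (assoc y x z) ⟩
    w ∙ (y ∙ (x ∙ z)) ≡⟨ assoc w y (x ∙ z) ⟨
    (w ∙ y) ∙ (x ∙ z) ∎

  module _ {B : Set} where

    sum-cong : ∀ (xs : List B) {f g} → (∀ x → f x ≡ g x) → sum xs f ≡ sum xs g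
    sum-cong []       eq = refl
    sum-cong (x ∷ xs) eq = cong₂ _∙_ (eq x) (sum-cong xs eq)

    sum-++ : ∀ (xs ys : List B) f → sum (xs ++ ys) f ≡ sum xs f ∙ sum ys f
    sum-++ []       ys f = sym (identityˡ _)
    sum-++ (x ∷ xs) ys f = trans (cong (f x ∙_) (sum-++ xs ys f)) (sym (assoc _ _ _))

    sum-ε : ∀ (xs : List B) {f} → (∀ x → f x ≡ ε) → sum xs f ≡ ε
    sum-ε []       eq = refl
    sum-ε (x ∷ xs) eq = trans (cong₂ _∙_ (eq x) (sum-ε xs eq)) (identityˡ ε)

    sum-∙ : ∀ (xs : List B) f g → sum xs (λ x → f x ∙ g x) ≡ sum xs f ∙ sum xs g
    sum-∙ []       f g = sym (identityˡ ε)
    sum-∙ (x ∷ xs) f g = trans (cong ((f x ∙ g x) ∙_) (sum-∙ xs f g)) (interchange _ _ _ _)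

    sum-filter : ∀ (p : B → Bool) xs f →
      sum (filter (λ x → p x Bool.≟ true) xs) f ≡ sum xs (λ x → if p x then f x else ε)
    sum-filter p []       f = refl
    sum-filter p (x ∷ xs) f with p x
    ... | true  = cong (f x ∙_) (sum-filter p xs f)
    ... | false = trans (sum-filter p xs f) (sym (identityˡ _))

    sum-filter-not : ∀ (p : B → Bool) xs f →
      sum (filter (λ x → p x Bool.≟ false) xs) f ≡ sum xs (λ x → if p x then ε else f x)
    sum-filter-not p []       f = refl
    sum-filter-not p (x ∷ xs) f with p x
    ... | true  = trans (sum-filter-not p xs f) (sym (identityˡ _))
    ... | false = cong (f x ∙_) (sum-filter-not p xs f)

    sum-↭ : ∀ {xs ys : List B} f → xs ↭ ys → sum xs f ≡ sum ys f
    sum-↭ f ↭.refl         = refl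
    sum-↭ f (↭.prep x p)   = cong (f x ∙_) (sum-↭ f p)
    sum-↭ f (↭.swap x y p) = begin
      f x ∙ (f y ∙ _) ≡⟨ assoc _ _ _ ⟨
      (f x ∙ f y) ∙ _ ≡⟨ cong₂ _∙_ (∙-comm (f x) (f y)) (sum-↭ f p) ⟩
      (f y ∙ f x) ∙ _ ≡⟨ assoc _ _ _ ⟩
      f y ∙ (f x ∙ _) ∎
    sum-↭ f (↭.trans p q)  = trans (sum-↭ f p) (sum-↭ f q)

  module _ {B C : Set} where

    sum-map : ∀ (h : B → C) xs f → sum (map h xs) f ≡ sum xs (f ∘ h)
    sum-map h []       f = refl
    sum-map h (x ∷ xs) f = cong (f (h x) ∙_) (sum-map h xs f)

    sum-concatMap : ∀ (h : B → List C) xs f → sum (concatMap h xs) f ≡ sum xs (λ x → sum (h x) f)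
    sum-concatMap h []       f = refl
    sum-concatMap h (x ∷ xs) f =
      trans (sum-++ (h x) (concatMap h xs) f) (cong (sum (h x) f ∙_) (sum-concatMap h xs f))

    sum-swap : ∀ (xs : List B) (ys : List C) (f : B → C → A) →
      sum xs (λ x → sum ys (λ y → f x y)) ≡ sum ys (λ y → sum xs (λ x → f x y))
    sum-swap []       ys f = sym (sum-ε ys (λ _ → refl))
    sum-swap (x ∷ xs) ys f = begin
      sum ys (f x) ∙ sum xs (λ x → sum ys (f x))               ≡⟨ cong (sum ys (f x) ∙_) (sum-swap xs ys f) ⟩
      sum ys (f x) ∙ sum ys (λ y → sum xs (λ x → f x y))       ≡⟨ sum-∙ ys _ _ ⟨
      sum ys (λ y → f x y ∙ sum xs (λ x → f x y))              ∎

  sumFin : (n : ℕ) → (Fin n → A) → A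
  sumFin n = sum (allFin n)

  sumFin-suc : ∀ {n} (f : Fin (suc n) → A) → sumFin (suc n) f ≡ f zero ∙ sumFin n (f ∘ suc)
  sumFin-suc {n} f = cong (f zero ∙_) (begin
    sum (tabulate suc) f        ≡⟨ cong (λ xs → sum xs f) (map-tabulate id suc) ⟨
    sum (map suc (allFin n)) f  ≡⟨ sum-map suc (allFin n) f ⟩
    sumFin n (f ∘ suc)          ∎)

  sumFin-single : ∀ {n} (k : Fin n) {f : Fin n → A} → (∀ i → i ≢ k → f i ≡ ε) → sumFin n f ≡ f k
  sumFin-single {suc n} zero {f} off = begin
    sumFin (suc n) f                ≡⟨ sumFin-suc f ⟩
    f zero ∙ sumFin n (f ∘ suc)     ≡⟨ cong (f zero ∙_) (sum-ε (allFin n) (λ i → off (suc i) λ ())) ⟩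
    f zero ∙ ε                      ≡⟨ identityʳ _ ⟩
    f zero                          ∎
  sumFin-single {suc n} (suc k) {f} off = begin
    sumFin (suc n) f                ≡⟨ sumFin-suc f ⟩
    f zero ∙ sumFin n (f ∘ suc)     ≡⟨ cong₂ _∙_ (off zero λ ())
        (sumFin-single k λ i i≢k → off (suc i) λ { refl → i≢k refl }) ⟩
    ε ∙ f (suc k)                   ≡⟨ identityˡ _ ⟩
    f (suc k)                       ∎

  sumFin-last : ∀ {n} (f : Fin (suc n) → A) → sumFin (suc n) f ≡ sumFin n (f ∘ inject₁) ∙ f (fromℕ n)
  sumFin-last {zero}  f = ∙-comm (f zero) ε
  sumFin-last {suc n} f = begin
    sumFin (2 ℕ.+ n) f                                                    ≡⟨ sumFin-suc f ⟩
    f zero ∙ sumFin (suc n) (f ∘ suc)                                     ≡⟨ cong (f zero ∙_)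
        (sumFin-last (f ∘ suc)) ⟩
    f zero ∙ (sumFin n (f ∘ suc ∘ inject₁) ∙ f (fromℕ (suc n)))          ≡⟨ assoc _ _ _ ⟨
    (f zero ∙ sumFin n (f ∘ suc ∘ inject₁)) ∙ f (fromℕ (suc n))          ≡⟨ cong (_∙ f (fromℕ (suc n)))
        (sumFin-suc (f ∘ inject₁)) ⟨
    sumFin (suc n) (f ∘ inject₁) ∙ f (fromℕ (suc n))                      ∎

  sumFin-+ : ∀ m n (f : Fin (m ℕ.+ n) → A) →
    sumFin (m ℕ.+ n) f ≡ sumFin m (λ i → f (i ↑ˡ n)) ∙ sumFin n (λ j → f (m ↑ʳ j))
  sumFin-+ zero    n f = sym (identityˡ _)
  sumFin-+ (suc m) n f = begin
    sumFin (suc m ℕ.+ n) f                         ≡⟨ sumFin-suc f ⟩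
    f zero ∙ sumFin (m ℕ.+ n) (f ∘ suc)            ≡⟨ cong (f zero ∙_) (sumFin-+ m n (f ∘ suc)) ⟩
    f zero ∙ (sumFin m _ ∙ sumFin n _)             ≡⟨ assoc _ _ _ ⟨
    (f zero ∙ sumFin m _) ∙ sumFin n _             ≡⟨ cong (_∙ sumFin n (λ j → f (suc m ↑ʳ j)))
        (sumFin-suc (λ i → f (i ↑ˡ n))) ⟨
    sumFin (suc m) _ ∙ sumFin n _                  ∎

-- Pairs of tilings

-- How a row of G is covered: by its edge in M₀ (neither), by its other horizontal edge (both), or by the
-- two parallel vertical edges leading up (first) or down (second).  Relative to M₀, the state of row y
-- contributes to the exponents through start and stop only.
data State : Set where
  neither both first second : State

start stop : State → ℕ
start neither = 0
start both    = 1
start first   = 1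
start second  = 0
stop neither = 0
stop both    = 1
stop first   = 0
stop second  = 1

-- Tiling true describes the upper part of a matching cut through a pair of vertical edges.
data Tiling : Bool → ℕ → Set where
  []    : Tiling false 0
  base  : ∀ {n} → Tiling false n → Tiling false (suc n)
  other : ∀ {n} → Tiling false n → Tiling false (suc n)
  lower : ∀ {n} → Tiling true n  → Tiling false (suc n)
  upper : ∀ {n} → Tiling false n → Tiling true (suc n)

states : ∀ {p n} → Tiling p n → Vec State n
states []        = []
states (base T)  = neither ∷ states T
states (other T) = both ∷ states T
states (lower T) = first ∷ states T
states (upper T) = second ∷ states T

tilings : ∀ p n → List (Tiling p n)
tilings false zero    = [] ∷ []
tilings true  zero    = []
tilings false (suc n) =
  map base (tilings false n) ++ (map other (tilings false n) ++ map lower (tilings true n))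
tilings true  (suc n) = map upper (tilings false n)

fromℤ : ℤ → ℚ
fromℤ z = z / 1

-- The determinant of the vectors (stop, start) of the two states. It is 0 if the states agree or
-- one is `neither`; otherwise it is 1 or -1 according to their order in the list `second`, `both`,
-- `first`.
crossing : State → State → ℚ
crossing s t =
  fromℤ (ℤ.+ stop s) * fromℤ (ℤ.+ start t) - fromℤ (ℤ.+ start s) * fromℤ (ℤ.+ stop t)

cross : ∀ {n} → Vec State n → Vec State n → ℚ
cross []       []       = 0ℚ
cross (s ∷ ss) (t ∷ ts) = crossing s t + cross ss ts

starts : ∀ {n} → Vec State n → ℕ
starts []       = 0
starts (s ∷ ss) = start s ℕ.+ starts ss

-- Invariant under exchanging the two tilings in any block of rows, and sufficient to recover the
-- product of their monomials.
Profile : ℕ → Set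
Profile = Vec (ℕ × ℕ)

profile : ∀ {n} → Vec State n → Vec State n → Profile n
profile = zipWith λ s t → (start s ℕ.+ start t , stop s ℕ.+ stop t)

module Σℚ = Summation ℚ.+-0-isCommutativeMonoid

module _ {n : ℕ} (p q : Bool) where

  pairSum : (Tiling p n → Tiling q n → ℚ) → ℚ
  pairSum g = Σℚ.sum (tilings p n) λ T → Σℚ.sum (tilings q n) λ U → g T U

  crossSum : (Tiling p n → Tiling q n → ℚ) → ℚ
  crossSum g = pairSum λ T U → cross (states T) (states U) * g T U

  pairSum-cong : ∀ {g h} → (∀ T U → g T U ≡ h T U) → pairSum g ≡ pairSum h
  pairSum-cong eq = Σℚ.sum-cong (tilings p n) λ T → Σℚ.sum-cong (tilings q n) λ U → eq T U

  pairSum-+ : ∀ g h → pairSum (λ T U → g T U + h T U) ≡ pairSum g + pairSum h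
  pairSum-+ g h =
    trans (Σℚ.sum-cong (tilings p n) λ T → Σℚ.sum-∙ (tilings q n) (g T) (h T))
          (Σℚ.sum-∙ (tilings p n) (λ T → Σℚ.sum (tilings q n) (g T)) (λ T → Σℚ.sum (tilings q n) (h T)))

  pairSum-0 : pairSum (λ _ _ → 0ℚ) ≡ 0ℚ
  pairSum-0 = Σℚ.sum-ε (tilings p n) λ _ → Σℚ.sum-ε (tilings q n) λ _ → refl

  pairSum-neg : ∀ g → pairSum (λ T U → - g T U) ≡ - pairSum g
  pairSum-neg g = begin
    pairSum -g                                ≡⟨ solve 2 (λ x y → x := x :+ y :- y) refl (pairSum -g) (pairSum g) ⟩
    pairSum -g + pairSum g - pairSum g        ≡⟨ cong (_- pairSum g) (sym (pairSum-+ -g g)) ⟩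
    pairSum (λ T U → - g T U + g T U) - pairSum g
      ≡⟨ cong (_- pairSum g) (trans (pairSum-cong λ T U → ℚ.+-inverseˡ (g T U)) pairSum-0) ⟩
    0ℚ - pairSum g                            ≡⟨ ℚ.+-identityˡ _ ⟩
    - pairSum g                               ∎
    where
    open ≡-Reasoning
    open +-*-Solver
    -g : Tiling p n → Tiling q n → ℚ
    -g T U = - g T U

  crossSum-shift : ∀ c g →
    pairSum (λ T U → (c + cross (states T) (states U)) * g T U) ≡ pairSum (λ T U → c * g T U) + crossSum g
  crossSum-shift c g =
    trans (pairSum-cong λ T U → ℚ.*-distribʳ-+ (g T U) c (cross (states T) (states U)))
          (pairSum-+ (λ T U → c * g T U) (λ T U → cross (states T) (states U) * g T U))

crossing-antisym : ∀ s t → crossing s t ≡ - crossing t s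
crossing-antisym s t =
  solve 4 (λ a b c d → a :* d :- b :* c := :- (c :* b :- d :* a)) refl
    (fromℤ (ℤ.+ stop s)) (fromℤ (ℤ.+ start s)) (fromℤ (ℤ.+ stop t)) (fromℤ (ℤ.+ start t))
  where open +-*-Solver

cross-antisym : ∀ {n} (ss ts : Vec State n) → cross ss ts ≡ - cross ts ss
cross-antisym []       []       = refl
cross-antisym (s ∷ ss) (t ∷ ts) =
  trans (cong₂ _+_ (crossing-antisym s t) (cross-antisym ss ts))
        (sym (ℚ.neg-distrib-+ (crossing t s) (cross ts ss)))

sum-tilings-suc : ∀ {n} f → Σℚ.sum (tilings false (suc n)) f ≡
  Σℚ.sum (tilings false n) (f ∘ base) + (Σℚ.sum (tilings false n) (f ∘ other) + Σℚ.sum (tilings true n) (f ∘ lower))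
sum-tilings-suc {n} f =
  trans (Σℚ.sum-++ (map base (tilings false n)) _ f) (cong₂ _+_ (Σℚ.sum-map base (tilings false n) f)
    (trans (Σℚ.sum-++ (map other (tilings false n)) _ f)
      (cong₂ _+_ (Σℚ.sum-map other (tilings false n) f) (Σℚ.sum-map lower (tilings true n) f))))

sum-tilings-sucʳ : ∀ {n} {A : Set} (xs : List A) (g : A → Tiling false (suc n) → ℚ) →
  Σℚ.sum xs (λ x → Σℚ.sum (tilings false (suc n)) (g x)) ≡
  Σℚ.sum xs (λ x → Σℚ.sum (tilings false n) (g x ∘ base)) +
  (Σℚ.sum xs (λ x → Σℚ.sum (tilings false n) (g x ∘ other)) +
   Σℚ.sum xs (λ x → Σℚ.sum (tilings true n) (g x ∘ lower)))
sum-tilings-sucʳ {n} {A} xs g =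
  trans (Σℚ.sum-cong xs λ x → sum-tilings-suc (g x))
    (trans (Σℚ.sum-∙ xs g₁ (λ x → g₂ x + g₃ x)) (cong₂ _+_ (refl {x = Σℚ.sum xs g₁}) (Σℚ.sum-∙ xs g₂ g₃)))
  where
  g₁ g₂ g₃ : A → ℚ
  g₁ x = Σℚ.sum (tilings false n) (g x ∘ base)
  g₂ x = Σℚ.sum (tilings false n) (g x ∘ other)
  g₃ x = Σℚ.sum (tilings true n) (g x ∘ lower)

pairSum-tf : ∀ {n} g → pairSum {suc n} true false g ≡
  pairSum false false (λ T U → g (upper T) (base U)) +
  (pairSum false false (λ T U → g (upper T) (other U)) + pairSum false true (λ T U → g (upper T) (lower U)))
pairSum-tf {n} g = trans (Σℚ.sum-map upper (tilings false n) _) (sum-tilings-sucʳ (tilings false n) (g ∘ upper))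

pairSum-tt : ∀ {n} g → pairSum {suc n} true true g ≡ pairSum false false (λ T U → g (upper T) (upper U))
pairSum-tt {n} g = trans (Σℚ.sum-map upper (tilings false n) _)
  (Σℚ.sum-cong (tilings false n) λ T → Σℚ.sum-map upper (tilings false n) _)

pairSum-ff : ∀ {n} g → pairSum {suc n} false false g ≡
  (pairSum false false (λ T U → g (base T) (base U)) +
    (pairSum false false (λ T U → g (base T) (other U)) + pairSum false true (λ T U → g (base T) (lower U)))) +
  ((pairSum false false (λ T U → g (other T) (base U)) +
     (pairSum false false (λ T U → g (other T) (other U)) + pairSum false true (λ T U → g (other T) (lower U)))) +
   (pairSum true false (λ T U → g (lower T) (base U)) +
     (pairSum true false (λ T U → g (lower T) (other U)) + pairSum true true (λ T U → g (lower T) (lower U)))))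
pairSum-ff {n} g = trans (sum-tilings-suc {n} _) (cong₂ _+_ (sum-tilings-sucʳ (tilings false n) (g ∘ base))
  (cong₂ _+_ (sum-tilings-sucʳ (tilings false n) (g ∘ other)) (sum-tilings-sucʳ (tilings true n) (g ∘ lower))))

-- Arbitrary functions, rather than indicators of fixed classes and a fixed monomial, so that
-- stripping a row of both tilings yields a weight again.
Weight : ℕ → Set
Weight n = ℕ → ℕ → Profile n → ℚ

weigh : ∀ {n p q} → Weight n → Tiling p n → Tiling q n → ℚ
weigh G T U = G (starts (states T)) (starts (states U)) (profile (states T) (states U))

-- After the bottom row is stripped, the delays restore its starts in the two classes, and `prepend`
-- restores its entry of the profile.
swapped delayˡ delayʳ : ∀ {n} → Weight n → Weight n
swapped G k l = G l k
delayˡ G k l = G (suc k) l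
delayʳ G k l = G k (suc l)

prepend : ∀ {n} → ℕ × ℕ → Weight (suc n) → Weight n
prepend x G k l P = G k l (x ∷ P)

profile-comm : ∀ {n} (ss ts : Vec State n) → profile ss ts ≡ profile ts ss
profile-comm []       []       = refl
profile-comm (s ∷ ss) (t ∷ ts) = cong₂ _∷_
  (cong₂ _,_ (ℕ.+-comm (start s) (start t)) (ℕ.+-comm (stop s) (stop t))) (profile-comm ss ts)

weigh-flip : ∀ {n p q} (G : Weight n) (T : Tiling p n) (U : Tiling q n) → weigh G T U ≡ weigh (swapped G) U T
weigh-flip G T U = cong (G (starts (states T)) (starts (states U))) (profile-comm (states T) (states U))

module _ {n : ℕ} (p q : Bool) (G : Weight n) where

  total crossTotal : ℚ
  total      = pairSum p q (weigh G)
  crossTotal = crossSum p q (weigh G)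

  -- This and the next two lemmas split off the crossing of a stripped bottom row, which is 0, 1 or
  -- -1.
  crossTotal-shift₀ : pairSum p q (λ T U → (0ℚ + cross (states T) (states U)) * weigh G T U) ≡ crossTotal
  crossTotal-shift₀ = pairSum-cong p q λ T U → cong (_* weigh G T U) (ℚ.+-identityˡ (cross (states T) (states U)))

  crossTotal-shift₊ :
    pairSum p q (λ T U → (1ℚ + cross (states T) (states U)) * weigh G T U) ≡ total + crossTotal
  crossTotal-shift₊ = trans (crossSum-shift p q 1ℚ (weigh G))
    (cong (_+ crossTotal) (pairSum-cong p q λ T U → ℚ.*-identityˡ (weigh G T U)))

  crossTotal-shift₋ :
    pairSum p q (λ T U → (- 1ℚ + cross (states T) (states U)) * weigh G T U) ≡ - total + crossTotal
  crossTotal-shift₋ = trans (crossSum-shift p q (- 1ℚ) (weigh G)) (cong (_+ crossTotal)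
    (trans (pairSum-cong p q λ T U → solve 1 (λ x → con (- 1ℚ) :* x := :- x) refl (weigh G T U))
           (pairSum-neg p q (weigh G))))
    where open +-*-Solver

module _ {n : ℕ} (p q : Bool) (G : Weight n) where

  total-flip : total p q G ≡ total q p (swapped G)
  total-flip = trans (Σℚ.sum-swap (tilings p n) (tilings q n) (weigh G))
    (pairSum-cong q p λ U T → weigh-flip G T U)

  crossTotal-flip : crossTotal p q G ≡ - crossTotal q p (swapped G)
  crossTotal-flip = trans (Σℚ.sum-swap (tilings p n) (tilings q n) λ T U → cross (states T)
      (states U) * weigh G T U) (trans
    (pairSum-cong q p λ U T → trans (cong₂ _*_ (cross-antisym (states T) (states U)) (weigh-flip G T U))
       (sym (ℚ.neg-distribˡ-* (cross (states U) (states T)) (weigh (swapped G) U T))))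
    (pairSum-neg q p λ U T → cross (states U) (states T) * weigh (swapped G) U T))

-- crossTotal-sym and excess-sym: above a height where exactly one tiling has a pair of vertical edges, it does
-- not matter which of the two classes is attributed to that tiling.  The antisymmetry of cross does the rest.
crossTotal-ff : ∀ n (G : Weight n) → crossTotal false false G ≡ 0ℚ
crossTotal-sym  : ∀ n (G : Weight n) →
  crossTotal true false (delayˡ G) ≡ crossTotal true false (delayˡ (swapped G))
excess-sym : ∀ n (G : Weight n) →
  total true false G - crossTotal true false G ≡ total true false (swapped G) - crossTotal true false (swapped G)

-- The parameter `null` is the induction hypothesis on the remaining rows.
module Recursion (n : ℕ) (null : ∀ (G : Weight n) → crossTotal false false G ≡ 0ℚ) where
  open +-*-Solver
  open ≡-Reasoning

  -- The weight left by a row in which the first tiling closes its pair and the second opens one.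
  -- The swap makes the tiling with the open pair the first one again.
  bothLower : Weight (suc n) → Weight n
  bothLower G = swapped (delayʳ (prepend (1 , 1) G))

  -- The first tiling closes its pair in the bottom row. Against `base` the crossing is 0 and the
  -- rest vanishes by `null`. Against `other` and `lower` it is 1, which adds the plain total; after
  -- `lower` the roles are exchanged, and antisymmetry gives the minus sign.
  crossTotal-tf : ∀ (G : Weight (suc n)) → crossTotal true false G ≡
    total false false (delayʳ (prepend (1 , 2) G)) +
    (total true false (bothLower G) - crossTotal true false (bothLower G))
  crossTotal-tf G = begin
    crossTotal true false G
      ≡⟨ pairSum-tf {n} (λ T U → cross (states T) (states U) * weigh G T U) ⟩
    _ ≡⟨ cong₂ _+_ (crossTotal-shift₀ false false A)
           (cong₂ _+_ (crossTotal-shift₊ false false B) (crossTotal-shift₊ false true C)) ⟩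
    crossTotal false false A +
      ((total false false B + crossTotal false false B) + (total false true C + crossTotal false true C))
      ≡⟨ cong₂ _+_ (null A) (cong₂ _+_ (cong₂ _+_ (refl {x = total false false B}) (null B))
           (cong₂ _+_ (total-flip false true C) (crossTotal-flip false true C))) ⟩
    0ℚ + ((total false false B + 0ℚ) + (c - d))
      ≡⟨ solve 3 (λ x y z → con 0ℚ :+ ((x :+ con 0ℚ) :+ (y :- z)) := x :+ (y :- z)) refl (total false false B) c d ⟩
    total false false B + (c - d) ∎
    where
    A B C : Weight n
    A = prepend (0 , 1) G
    B = delayʳ (prepend (1 , 2) G)
    C = delayʳ (prepend (1 , 1) G)
    c d : ℚ
    c = total true false (bothLower G)
    d = crossTotal true false (bothLower G)

  -- The totals for `other` and `lower` occur both in the total and in the crossing sum. Their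
  -- cancellation leads from the excess back to a crossing sum, so the two recursions alternate.
  excess-tf : ∀ (G : Weight (suc n)) →
    total true false G - crossTotal true false G ≡
    total false false (prepend (0 , 1) G) + crossTotal true false (bothLower G)
  excess-tf G = begin
    total true false G - crossTotal true false G
      ≡⟨ cong₂ _-_ (pairSum-tf {n} (weigh G)) (crossTotal-tf G) ⟩
    (a + (b + total false true (swapped (bothLower G)))) - (b + (c - d))
      ≡⟨ cong (λ x → (a + (b + x)) - (b + (c - d))) (total-flip false true (swapped (bothLower G))) ⟩
    (a + (b + c)) - (b + (c - d))
      ≡⟨ solve 4 (λ a b c d → (a :+ (b :+ c)) :- (b :+ (c :- d)) := a :+ d) refl a b c d ⟩
    a + d ∎
    where
    a b c d : ℚ
    a = total false false (prepend (0 , 1) G)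
    b = total false false (delayʳ (prepend (1 , 2) G))
    c = total true false (bothLower G)
    d = crossTotal true false (bothLower G)

crossTotal-sym zero    G = refl
crossTotal-sym (suc n) G = begin
  crossTotal true false (delayˡ G)
    ≡⟨ crossTotal-tf (delayˡ G) ⟩
  -- The start of the old pair and the start in this row shift both classes by one. The shifts are
  -- equal, so the unshifted symmetries apply.
  _ ≡⟨ cong₂ _+_ (total-flip false false (delayʳ (prepend (1 , 2) (delayˡ G))))
                 (excess-sym n (bothLower (delayˡ G))) ⟩
  _ ≡⟨ crossTotal-tf (delayˡ (swapped G)) ⟨
  crossTotal true false (delayˡ (swapped G)) ∎
  where
  open Recursion n (crossTotal-ff n)
  open ≡-Reasoning

excess-sym zero    G = refl
excess-sym (suc n) G = begin
  total true false G - crossTotal true false G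
    ≡⟨ excess-tf G ⟩
  -- Only the start of the newly opened pair shifts a class, which is the delayed form of
  -- `crossTotal-sym`.
  _ ≡⟨ cong₂ _+_ (total-flip false false (prepend (0 , 1) G)) (crossTotal-sym n (swapped (prepend (1 , 1) G))) ⟩
  _ ≡⟨ excess-tf (swapped G) ⟨
  total true false (swapped G) - crossTotal true false (swapped G) ∎
  where
  open Recursion n (crossTotal-ff n)
  open ≡-Reasoning

-- Both tilings close their pairs in the same row: its crossing is 0, and above it no pair is open.
crossTotal-tt : ∀ n (G : Weight n) → crossTotal true true G ≡ 0ℚ
crossTotal-tt zero    G = refl
crossTotal-tt (suc n) G = trans (pairSum-tt {n} (λ T U → cross (states T) (states U) * weigh G T U))
  (trans (crossTotal-shift₀ false false (prepend (0 , 2) G)) (crossTotal-ff n (prepend (0 , 2) G)))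

crossTotal-ff zero    G = solve 1 (λ x → (con 0ℚ :* x :+ con 0ℚ) :+ con 0ℚ := con 0ℚ) refl (G 0 0 [])
  where open +-*-Solver
crossTotal-ff (suc n) G = begin
  crossTotal false false G
    ≡⟨ pairSum-ff {n} (λ T U → cross (states T) (states U) * weigh G T U) ⟩
  -- Nine choices of bottom rows. The four without vertical edges vanish by induction, and `lower`
  -- against `lower` by `crossTotal-tt`. The other four cancel in twos: `base` and `lower` against
  -- the reverse, `other` and `lower` against the reverse.
  _ ≡⟨ cong₂ _+_
         (cong₂ _+_ (null₀ (prepend (0 , 0) G))
           (cong₂ _+_ (null₀ (delayʳ (prepend (1 , 1) G))) (crossTotal-shift₀ false true (swapped C))))
         (cong₂ _+_
           (cong₂ _+_ (null₀ (delayˡ (prepend (1 , 1) G)))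
             (cong₂ _+_ (null₀ (delayˡ (delayʳ (prepend (2 , 2) G)))) (crossTotal-shift₊ false true (swapped D))))
           (cong₂ _+_ (crossTotal-shift₀ true false C′)
             (cong₂ _+_ (crossTotal-shift₋ true false D′)
               (trans (crossTotal-shift₀ true true E) (crossTotal-tt n E))))) ⟩
  (0ℚ + (0ℚ + crossTotal false true (swapped C))) +
    ((0ℚ + (0ℚ + (total false true (swapped D) + crossTotal false true (swapped D)))) + (x + ((- y + z) + 0ℚ)))
    -- Flipping the tilings also flips the classes; the two symmetry lemmas flip the classes back.
    ≡⟨ cong₂ (λ u v → (0ℚ + (0ℚ + u)) + ((0ℚ + (0ℚ + v)) + (x + ((- y + z) + 0ℚ))))
         (trans (crossTotal-flip false true (swapped C))
                (cong (-_) (crossTotal-sym n (swapped (prepend (1 , 0) G)))))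
         (trans (cong₂ _+_ (total-flip false true (swapped D)) (crossTotal-flip false true (swapped D)))
                (excess-sym n D)) ⟩
  (0ℚ + (0ℚ + - x)) + ((0ℚ + (0ℚ + (y - z))) + (x + ((- y + z) + 0ℚ)))
    ≡⟨ solve 3 (λ x y z → (con 0ℚ :+ (con 0ℚ :+ :- x)) :+
         ((con 0ℚ :+ (con 0ℚ :+ (y :- z))) :+ (x :+ ((:- y :+ z) :+ con 0ℚ))) := con 0ℚ) refl x y z ⟩
  0ℚ ∎
  where
  open +-*-Solver
  open ≡-Reasoning
  null₀ : ∀ (G : Weight n) →
    pairSum false false (λ T U → (0ℚ + cross (states T) (states U)) * weigh G T U) ≡ 0ℚ
  null₀ G = trans (crossTotal-shift₀ false false G) (crossTotal-ff n G)
  C C′ D D′ E : Weight n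
  C = swapped (delayʳ (prepend (1 , 0) G))
  C′ = delayˡ (prepend (1 , 0) G)
  D = swapped (delayˡ (delayʳ (prepend (2 , 1) G)))
  D′ = delayˡ (delayʳ (prepend (2 , 1) G))
  E = delayˡ (delayʳ (prepend (2 , 0) G))
  x y z : ℚ
  x = crossTotal true false C′
  y = total true false D′
  z = crossTotal true false D′

-- The inverse Cartan matrix

sum-*ˡ : ∀ {A : Set} (xs : List A) c f → Σℚ.sum xs (λ x → c * f x) ≡ c * Σℚ.sum xs f
sum-*ˡ []       c f = sym (ℚ.*-zeroʳ c)
sum-*ˡ (x ∷ xs) c f = trans (cong (c * f x +_) (sum-*ˡ xs c f)) (sym (ℚ.*-distribˡ-+ c (f x) _))

sum-*ʳ : ∀ {A : Set} (xs : List A) c f → Σℚ.sum xs (λ x → f x * c) ≡ Σℚ.sum xs f * c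
sum-*ʳ xs c f = trans (Σℚ.sum-cong xs λ x → ℚ.*-comm (f x) c) (trans (sum-*ˡ xs c f) (ℚ.*-comm c _))

sum-neg : ∀ {A : Set} (xs : List A) f → Σℚ.sum xs (λ x → - f x) ≡ - Σℚ.sum xs f
sum-neg []       f = refl
sum-neg (x ∷ xs) f = trans (cong (- f x +_) (sum-neg xs f)) (sym (ℚ.neg-distrib-+ (f x) _))

sum-minus : ∀ {A : Set} (xs : List A) f g → Σℚ.sum xs (λ x → f x - g x) ≡ Σℚ.sum xs f - Σℚ.sum xs g
sum-minus xs f g = trans (Σℚ.sum-∙ xs f (λ x → - g x)) (cong (Σℚ.sum xs f +_) (sum-neg xs g))

Δ : ∀ {r} → (Fin (suc r) → ℚ) → Fin r → ℚ
Δ p a = p (suc a) - p (inject₁ a)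

partialSum : ∀ {n} → (Fin n → ℚ) → Fin n → ℚ
partialSum p zero    = p zero
partialSum p (suc a) = p zero + partialSum (p ∘ suc) a

partialSum-last : ∀ {n} (p : Fin (suc n) → ℚ) → partialSum p (fromℕ n) ≡ Σℚ.sumFin (suc n) p
partialSum-last {zero}  p = sym (ℚ.+-identityʳ (p zero))
partialSum-last {suc n} p = trans (cong (p zero +_) (partialSum-last (p ∘ suc))) (sym (Σℚ.sumFin-suc p))

partialSum-suc : ∀ {n} (p : Fin (suc n) → ℚ) (a : Fin n) →
  partialSum p (suc a) ≡ partialSum p (inject₁ a) + p (suc a)
partialSum-suc p zero    = refl
partialSum-suc p (suc a) =
  trans (cong (p zero +_) (partialSum-suc (p ∘ suc) a)) (sym (ℚ.+-assoc (p zero) _ _))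

Δ-partialSum : ∀ {n} (p : Fin (suc n) → ℚ) a → Δ (partialSum p) a ≡ p (suc a)
Δ-partialSum p a = trans (cong (_- partialSum p (inject₁ a)) (partialSum-suc p a))
  (solve 2 (λ x y → (x :+ y) :- x := y) refl (partialSum p (inject₁ a)) (p (suc a)))
  where open +-*-Solver

-- The boundary term at zero stays inside the bracket: for `t = partialSum q` the bracket is then
-- the sum of `q y * p y` over all rows.
sum-by-parts : ∀ {r} (p t : Fin (suc r) → ℚ) →
  Σℚ.sumFin r (λ a → t (inject₁ a) * Δ p a) ≡
  t (fromℕ r) * p (fromℕ r) - (t zero * p zero + Σℚ.sumFin r (λ a → Δ t a * p (suc a)))
sum-by-parts {zero}  p t = solve 1 (λ x → con 0ℚ := x :- (x :+ con 0ℚ)) refl (t zero * p zero)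
  where open +-*-Solver
sum-by-parts {suc r} p t = begin
  Σℚ.sumFin (suc r) (λ a → t (inject₁ a) * Δ p a)
    ≡⟨ Σℚ.sumFin-suc (λ a → t (inject₁ a) * Δ p a) ⟩
  t zero * Δ p zero + Σℚ.sumFin r (λ a → t (suc (inject₁ a)) * Δ (p ∘ suc) a)
    ≡⟨ cong (t zero * Δ p zero +_) (sum-by-parts (p ∘ suc) (t ∘ suc)) ⟩
  t zero * (p₁ - p zero) + (l - (t₁ * p₁ + s))
    ≡⟨ solve 6 (λ t₀ p₀ t₁ p₁ l s → t₀ :* (p₁ :- p₀) :+ (l :- (t₁ :* p₁ :+ s)) :=
         l :- (t₀ :* p₀ :+ ((t₁ :- t₀) :* p₁ :+ s))) refl (t zero) (p zero) t₁ p₁ l s ⟩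
  l - (t zero * p zero + (Δ t zero * p₁ + s))
    ≡⟨ cong (λ x → l - (t zero * p zero + x)) (Σℚ.sumFin-suc (λ a → Δ t a * p (suc a))) ⟨
  l - (t zero * p zero + Σℚ.sumFin (suc r) (λ a → Δ t a * p (suc a))) ∎
  where
  open ≡-Reasoning
  open +-*-Solver
  t₁ p₁ l s : ℚ
  t₁ = t (suc zero)
  p₁ = p (suc zero)
  l = t (fromℕ (suc r)) * p (fromℕ (suc r))
  s = Σℚ.sumFin r (λ a → Δ (t ∘ suc) a * p (suc (suc a)))

atLast : ∀ {r} → Fin r → ℚ → ℚ
atLast {suc zero}    zero    x = x
atLast {suc (suc _)} zero    x = 0ℚ
atLast               (suc b) x = atLast b x

atLast-inject₁ : ∀ {r} (b : Fin r) x → atLast (inject₁ b) x ≡ 0ℚ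
atLast-inject₁ {suc r} zero    x = refl
atLast-inject₁ (suc b) x = atLast-inject₁ b x

atLast-fromℕ : ∀ r x → atLast (fromℕ r) x ≡ x
atLast-fromℕ zero    x = refl
atLast-fromℕ (suc r) x = atLast-fromℕ r x

sum-atLast : ∀ {r} (φ : Fin (suc r) → ℚ) x →
  Σℚ.sumFin (suc r) (λ b → φ b * atLast b x) ≡ φ (fromℕ r) * x
sum-atLast {r} φ x = begin
  Σℚ.sumFin (suc r) (λ b → φ b * atLast b x)
    ≡⟨ Σℚ.sumFin-last (λ b → φ b * atLast b x) ⟩
  Σℚ.sumFin r (λ b → φ (inject₁ b) * atLast (inject₁ b) x) + φ (fromℕ r) * atLast (fromℕ r) x
    ≡⟨ cong₂ _+_ (Σℚ.sum-ε (allFin r) λ b →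
         trans (cong (φ (inject₁ b) *_) (atLast-inject₁ b x)) (ℚ.*-zeroʳ (φ (inject₁ b))))
         (cong (φ (fromℕ r) *_) (atLast-fromℕ r x)) ⟩
  0ℚ + φ (fromℕ r) * x
    ≡⟨ ℚ.+-identityˡ _ ⟩
  φ (fromℕ r) * x ∎
  where open ≡-Reasoning

previous : ∀ {r} → (Fin (suc r) → ℚ) → Fin r → ℚ
previous t zero    = 0ℚ
previous t (suc b) = t (inject₁ (inject₁ b))

-- A second difference written as a difference of two increments. The first row lacks a left
-- neighbour, which `previous` sets to 0; the last row lacks its right neighbour `t (fromℕ r)`,
-- which `atLast` adds back.
cartan-row : ∀ {r} (t : Fin (suc r) → ℚ) (b : Fin r) →
  Σℚ.sumFin r (λ c → CartanA r b c * t (inject₁ c)) ≡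
  (t (inject₁ b) - previous t b) - Δ t b + atLast b (t (fromℕ r))
cartan-row {suc zero} t zero =
  solve 2 (λ x y → con (ℤ.+ 2 / 1) :* x :+ con 0ℚ := (x :- con 0ℚ) :- (y :- x) :+ y) refl (t zero) (t (suc zero))
  where open +-*-Solver
cartan-row {suc (suc r)} t zero = begin
  Σℚ.sumFin (suc (suc r)) (λ c → CartanA (suc (suc r)) zero c * t (inject₁ c))
    ≡⟨ Σℚ.sumFin-suc (λ c → CartanA (suc (suc r)) zero c * t (inject₁ c)) ⟩
  _ ≡⟨ cong ((ℤ.+ 2 / 1) * t zero +_) (Σℚ.sumFin-suc (λ c → CartanA (suc (suc r)) zero (suc c) * t
      (inject₁ (suc c)))) ⟩
  (ℤ.+ 2 / 1) * t zero + ((ℤ.-[1+ 0 ] / 1) * t (suc zero) + Σℚ.sumFin r (λ c → 0ℚ * t (suc (suc (inject₁ c)))))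
    ≡⟨ cong (λ x → (ℤ.+ 2 / 1) * t zero + ((ℤ.-[1+ 0 ] / 1) * t (suc zero) + x))
         (Σℚ.sum-ε (allFin r) (λ c → ℚ.*-zeroˡ (t (suc (suc (inject₁ c)))))) ⟩
  (ℤ.+ 2 / 1) * t zero + ((ℤ.-[1+ 0 ] / 1) * t (suc zero) + 0ℚ)
    ≡⟨ solve 2 (λ x y → con (ℤ.+ 2 / 1) :* x :+ (con (ℤ.-[1+ 0 ] / 1) :* y :+ con 0ℚ) :=
          (x :- con 0ℚ) :- (y :- x) :+ con 0ℚ) refl (t zero) (t (suc zero)) ⟩
  (t zero - 0ℚ) - (t (suc zero) - t zero) + 0ℚ ∎
  where
  open ≡-Reasoning
  open +-*-Solver
cartan-row {suc (suc r)} t (suc b) = begin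
  Σℚ.sumFin (suc (suc r)) (λ c → CartanA (suc (suc r)) (suc b) c * t (inject₁ c))
    ≡⟨ Σℚ.sumFin-suc (λ c → CartanA (suc (suc r)) (suc b) c * t (inject₁ c)) ⟩
  -- Shifting the index makes `previous` lose `t zero`. Only the second row notices, and there
  -- column 0 of the matrix supplies the term.
  _ ≡⟨ cong₂ _+_ (first-column b) (cartan-row (t ∘ suc) b) ⟩
  (previous (t ∘ suc) b - previous t (suc b)) + ((x - previous (t ∘ suc) b) - d + e)
    ≡⟨ solve 5 (λ u v x d e → (u :- v) :+ ((x :- u) :- d :+ e) := (x :- v) :- d :+ e) refl
         (previous (t ∘ suc) b) (previous t (suc b)) x d e ⟩
  (x - previous t (suc b)) - d + e ∎
  where
  open ≡-Reasoning
  open +-*-Solver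
  x d e : ℚ
  x = t (suc (inject₁ b))
  d = Δ (t ∘ suc) b
  e = atLast b (t (fromℕ (suc (suc r))))
  first-column : ∀ (b : Fin (suc r)) →
    CartanA (suc (suc r)) (suc b) zero * t zero ≡ previous (t ∘ suc) b - previous t (suc b)
  first-column zero    = solve 1 (λ x → con (ℤ.-[1+ 0 ] / 1) :* x := con 0ℚ :- x) refl (t zero)
  first-column (suc b) = solve 2 (λ x y → con 0ℚ :* x := y :- y) refl (t zero) (t (suc (inject₁ (inject₁ b))))

-- Partial sums invert Δ, so the Cartan matrix applied to them is -Δ, except for the missing last neighbour.
cartan-partialSum : ∀ {r} (p : Fin (suc r) → ℚ) (b : Fin r) →
  Δ p b ≡ atLast b (Σℚ.sumFin (suc r) p) - Σℚ.sumFin r (λ c → CartanA r b c * partialSum p (inject₁ c))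
cartan-partialSum {r} p b = begin
  p (suc b) - p (inject₁ b)
    ≡⟨ solve 3 (λ e x y → y :- x := e :- (x :- y :+ e)) refl e (p (inject₁ b)) (p (suc b)) ⟩
  e - (p (inject₁ b) - p (suc b) + e)
    ≡⟨ cong₂ (λ x y → e - (x - y + e)) (increment b) (sym (Δ-partialSum p b)) ⟩
  e - ((s (inject₁ b) - previous s b) - Δ s b + e)
    ≡⟨ cong (λ x → e - ((s (inject₁ b) - previous s b) - Δ s b + atLast b x)) (sym (partialSum-last p)) ⟩
  e - ((s (inject₁ b) - previous s b) - Δ s b + atLast b (s (fromℕ r)))
    ≡⟨ cong (λ x → e - x) (sym (cartan-row s b)) ⟩
  e - Σℚ.sumFin r (λ c → CartanA r b c * s (inject₁ c)) ∎
  where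
  open ≡-Reasoning
  open +-*-Solver
  e : ℚ
  e = atLast b (Σℚ.sumFin (suc r) p)
  s : Fin (suc r) → ℚ
  s = partialSum p
  increment : ∀ b → p (inject₁ b) ≡ s (inject₁ b) - previous s b
  increment zero    = solve 1 (λ x → x := x :- con 0ℚ) refl (p zero)
  increment (suc b) = sym (Δ-partialSum p (inject₁ b))

≡ᵇ-sym : ∀ m n → (m ≡ᵇ n) ≡ (n ≡ᵇ m)
≡ᵇ-sym zero    zero    = refl
≡ᵇ-sym zero    (suc n) = refl
≡ᵇ-sym (suc m) zero    = refl
≡ᵇ-sym (suc m) (suc n) = ≡ᵇ-sym m n

sum-identity : ∀ {r} (a : Fin r) (f : Fin r → ℚ) → Σℚ.sumFin r (λ c → identity a c * f c) ≡ f a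
sum-identity {r} a f = trans
  (Σℚ.sumFin-single a {f = λ c → identity a c * f c} λ c c≢a →
    trans (cong (λ b → (if b then 1ℚ else 0ℚ) * f c) (dec-false (toℕ a ℕ.≟ toℕ c) (c≢a ∘ sym ∘ Fin.toℕ-injective)))
        (ℚ.*-zeroˡ (f c)))
  (trans (cong (λ b → (if b then 1ℚ else 0ℚ) * f a) (dec-true (toℕ a ℕ.≟ toℕ a) refl)) (ℚ.*-identityˡ (f a)))

identity-sym : ∀ {r} (a c : Fin r) → identity a c ≡ identity c a
identity-sym a c = cong (if_then 1ℚ else 0ℚ) (≡ᵇ-sym (toℕ a) (toℕ c))

CartanA-sym : ∀ {r} (a c : Fin r) → CartanA r a c ≡ CartanA r c a
CartanA-sym a c rewrite ≡ᵇ-sym (toℕ a) (toℕ c) with toℕ c ≡ᵇ toℕ a | suc (toℕ a) ≡ᵇ toℕ c | suc (toℕ c) ≡ᵇ toℕ a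
... | true  | _     | _     = refl
... | false | true  | true  = refl
... | false | true  | false = refl
... | false | false | true  = refl
... | false | false | false = refl

-- Stated for any `φ` that the Cartan matrix sends to a unit row: besides the rows of `X` this
-- covers its last column, by symmetry of the Cartan matrix.
inverse-row-Δ : ∀ {r} (φ : Fin (suc r) → ℚ) a →
  (∀ c → Σℚ.sumFin (suc r) (λ b → φ b * CartanA (suc r) b c) ≡ identity a c) →
  ∀ p → Σℚ.sumFin (suc r) (λ b → φ b * Δ p b) ≡
        φ (fromℕ r) * Σℚ.sumFin (suc (suc r)) p - partialSum p (inject₁ a)
inverse-row-Δ {r} φ a φC p = begin
  Σ₁ (λ b → φ b * Δ p b)
    ≡⟨ Σℚ.sum-cong bs (λ b → trans (cong (φ b *_) (cartan-partialSum p b))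
         (solve 3 (λ x y z → x :* (y :- z) := x :* y :- x :* z) refl (φ b) (atLast b S) (Σ₁ λ c → C b c * s c))) ⟩
  Σ₁ (λ b → φ b * atLast b S - φ b * Σ₁ (λ c → C b c * s c))
    ≡⟨ sum-minus bs (λ b → φ b * atLast b S) (λ b → φ b * Σ₁ (λ c → C b c * s c)) ⟩
  Σ₁ (λ b → φ b * atLast b S) - Σ₁ (λ b → φ b * Σ₁ (λ c → C b c * s c))
    ≡⟨ cong₂ _-_ (sum-atLast φ S) (Σℚ.sum-cong bs λ b → sym (sum-*ˡ bs (φ b) λ c → C b c * s c)) ⟩
  φ (fromℕ r) * S - Σ₁ (λ b → Σ₁ (λ c → φ b * (C b c * s c)))
    ≡⟨ cong (λ x → φ (fromℕ r) * S - x) (Σℚ.sum-swap bs bs λ b c → φ b * (C b c * s c)) ⟩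
  φ (fromℕ r) * S - Σ₁ (λ c → Σ₁ (λ b → φ b * (C b c * s c)))
    ≡⟨ cong (λ x → φ (fromℕ r) * S - x) (Σℚ.sum-cong bs λ c →
         trans (Σℚ.sum-cong bs λ b → sym (ℚ.*-assoc (φ b) (C b c) (s c)))
         (trans (sum-*ʳ bs (s c) λ b → φ b * C b c) (cong (_* s c) (φC c)))) ⟩
  φ (fromℕ r) * S - Σ₁ (λ c → identity a c * s c)
    ≡⟨ cong (λ x → φ (fromℕ r) * S - x) (sum-identity a s) ⟩
  φ (fromℕ r) * S - s a ∎
  where
  open ≡-Reasoning
  open +-*-Solver
  bs : List (Fin (suc r))
  bs = allFin (suc r)
  Σ₁ : (Fin (suc r) → ℚ) → ℚ
  Σ₁ = Σℚ.sumFin (suc r)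
  C : Fin (suc r) → Fin (suc r) → ℚ
  C = CartanA (suc r)
  S : ℚ
  S = Σℚ.sumFin (suc (suc r)) p
  s : Fin (suc r) → ℚ
  s c = partialSum p (inject₁ c)

-- Invert in `q` by rows, in `p` by the last column, and sum by parts; the terms in `p top` cancel.
-- The corner entry of the inverse is (r+1)/(r+2), so the right side is the inner product of `p` and
-- `q` after their means are subtracted.
inverse-form-Δ : ∀ {r X} → IsCartanInverse (suc r) X → (p q : Fin (suc (suc r)) → ℚ) →
  Σℚ.sumFin (suc r) (λ a → Σℚ.sumFin (suc r) λ b → X a b * (Δ p a * Δ q b)) ≡
  Σℚ.sumFin (suc (suc r)) (λ y → p y * q y) +
  (X (fromℕ r) (fromℕ r) - 1ℚ) * (Σℚ.sumFin (suc (suc r)) p * Σℚ.sumFin (suc (suc r)) q)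
inverse-form-Δ {r} {X} (CX , XC) p q = begin
  Σ₁ (λ a → Σ₁ λ b → X a b * (Δ p a * Δ q b))
    ≡⟨ Σℚ.sum-cong bs (λ a → trans (Σℚ.sum-cong bs λ b →
         solve 3 (λ x y z → x :* (y :* z) := y :* (x :* z)) refl (X a b) (Δ p a) (Δ q b))
         (trans (sum-*ˡ bs (Δ p a) λ b → X a b * Δ q b)
                (cong (Δ p a *_) (inverse-row-Δ (X a) a (XC a) q)))) ⟩
  Σ₁ (λ a → Δ p a * (X a l * Q - s (inject₁ a)))
    ≡⟨ Σℚ.sum-cong bs (λ a →
         solve 4 (λ d x Q s → d :* (x :* Q :- s) := (x :* d) :* Q :- s :* d) refl (Δ p a) (X a l) Q (s (inject₁ a))) ⟩
  Σ₁ (λ a → (X a l * Δ p a) * Q - s (inject₁ a) * Δ p a)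
    ≡⟨ sum-minus bs (λ a → (X a l * Δ p a) * Q) (λ a → s (inject₁ a) * Δ p a) ⟩
  Σ₁ (λ a → (X a l * Δ p a) * Q) - Σ₁ (λ a → s (inject₁ a) * Δ p a)
    ≡⟨ cong₂ _-_ (trans (sum-*ʳ bs Q λ a → X a l * Δ p a) (cong (_* Q) (inverse-row-Δ (λ a → X a l) l column p)))
         (sum-by-parts p s) ⟩
  (X l l * P - partialSum p (inject₁ l)) * Q -
    (s top * p top - (s zero * p zero + Σ₁ (λ a → Δ s a * p (suc a))))
    ≡⟨ cong₂ (λ x y → (X l l * P - partialSum p (inject₁ l)) * Q - (x * p top - y))
         (partialSum-last q) (trans (cong (q zero * p zero +_)
             (Σℚ.sum-cong bs λ a → cong (_* p (suc a)) (Δ-partialSum q a)))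
           (sym (Σℚ.sumFin-suc λ y → q y * p y))) ⟩
  (X l l * P - partialSum p (inject₁ l)) * Q - (Q * p top - Σ₂ (λ y → q y * p y))
    ≡⟨ cong₂ (λ x y → (X l l * P - x) * Q - (Q * p top - y)) penultimate
        (Σℚ.sum-cong (allFin (suc (suc r))) λ y → ℚ.*-comm (q y) (p y)) ⟩
  (X l l * P - (P - p top)) * Q - (Q * p top - Σ₂ (λ y → p y * q y))
    ≡⟨ solve 5 (λ x P Q t s → (x :* P :- (P :- t)) :* Q :- (Q :* t :- s) := s :+ (x :- con 1ℚ) :* (P :* Q)) refl
         (X l l) P Q (p top) (Σ₂ (λ y → p y * q y)) ⟩
  Σ₂ (λ y → p y * q y) + (X l l - 1ℚ) * (P * Q) ∎
  where
  open ≡-Reasoning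
  open +-*-Solver
  bs : List (Fin (suc r))
  bs = allFin (suc r)
  Σ₁ : (Fin (suc r) → ℚ) → ℚ
  Σ₁ = Σℚ.sumFin (suc r)
  Σ₂ : (Fin (suc (suc r)) → ℚ) → ℚ
  Σ₂ = Σℚ.sumFin (suc (suc r))
  l : Fin (suc r)
  l = fromℕ r
  top : Fin (suc (suc r))
  top = fromℕ (suc r)
  P Q : ℚ
  P = Σ₂ p
  Q = Σ₂ q
  s : Fin (suc (suc r)) → ℚ
  s = partialSum q
  penultimate : partialSum p (inject₁ l) ≡ P - p top
  penultimate = trans
    (solve 2 (λ x y → x := (x :+ y) :- y) refl (partialSum p (inject₁ l)) (p top))
    (cong (_- p top) (trans (sym (partialSum-suc p l)) (partialSum-last p)))
  column : ∀ c → Σ₁ (λ b → X b l * CartanA (suc r) b c) ≡ identity l c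
  column c = trans (Σℚ.sum-cong bs λ b → trans (ℚ.*-comm (X b l) _) (cong (_* X b l) (CartanA-sym b c)))
    (trans (CX c l) (identity-sym c l))

-- The form Ω on exponents of tilings

fromℤ-+ : ∀ x y → fromℤ (x ℤ.+ y) ≡ fromℤ x + fromℤ y
fromℤ-+ x y = sym (trans (cong₂ _+_ (ℚ.↥p/↧p≡p (mkℚ x 0 (coprime x))) (ℚ.↥p/↧p≡p (mkℚ y 0 (coprime y))))
  (cong₂ (λ a b → fromℤ (a ℤ.+ b)) (ℤ.*-identityʳ x) (ℤ.*-identityʳ y)))
  where
  coprime : ∀ z → Coprimality.Coprime ℤ.∣ z ∣ 1
  coprime z = Coprimality.sym (Coprimality.1-coprimeTo ℤ.∣ z ∣)

fromℤ-neg : ∀ x → fromℤ (ℤ.- x) ≡ - fromℤ x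
fromℤ-neg ℤ.-[1+ n ] = solve 1 (λ x → x := :- (:- x)) refl (fromℤ (ℤ.+ suc n))
  where open +-*-Solver
fromℤ-neg (ℤ.+ zero)  = refl
fromℤ-neg (ℤ.+ suc n) = refl

fromℤ-minus : ∀ x y → fromℤ (x ℤ.- y) ≡ fromℤ x - fromℤ y
fromℤ-minus x y = trans (fromℤ-+ x (ℤ.- y)) (cong (fromℤ x +_) (fromℤ-neg y))

startAt stopAt : ∀ {n} → Vec State n → Fin n → ℚ
startAt ss y = fromℤ (ℤ.+ start (lookup ss y))
stopAt ss y  = fromℤ (ℤ.+ stop (lookup ss y))

cross-sum : ∀ {n} (ss ts : Vec State n) →
  cross ss ts ≡ Σℚ.sumFin n (λ y → stopAt ss y * startAt ts y - startAt ss y * stopAt ts y)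
cross-sum []       []       = refl
cross-sum (s ∷ ss) (t ∷ ts) = trans (cong (crossing s t +_) (cross-sum ss ts))
  (sym (Σℚ.sumFin-suc λ y → stopAt (s ∷ ss) y * startAt (t ∷ ts) y - startAt (s ∷ ss) y * stopAt (t ∷ ts) y))

sum-startAt-∷ : ∀ {n} s (ss : Vec State n) →
  Σℚ.sumFin (suc n) (startAt (s ∷ ss)) ≡ fromℤ (ℤ.+ start s) + Σℚ.sumFin n (startAt ss)
sum-startAt-∷ s ss = Σℚ.sumFin-suc (startAt (s ∷ ss))

sum-stopAt-∷ : ∀ {n} s (ss : Vec State n) →
  Σℚ.sumFin (suc n) (stopAt (s ∷ ss)) ≡ fromℤ (ℤ.+ stop s) + Σℚ.sumFin n (stopAt ss)
sum-stopAt-∷ s ss = Σℚ.sumFin-suc (stopAt (s ∷ ss))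

-- Each pair of vertical edges has one start and one stop. A tiling cut through a pair keeps the
-- stop of that pair and has lost its start.
stop-balance : ∀ {p n} (T : Tiling p n) →
  Σℚ.sumFin n (stopAt (states T)) ≡ (if p then 1ℚ else 0ℚ) + Σℚ.sumFin n (startAt (states T))
stop-balance []        = refl
stop-balance (base T)  = trans (sum-stopAt-∷ neither (states T)) (trans (cong (0ℚ +_) (stop-balance T))
  (cong (0ℚ +_) (sym (sum-startAt-∷ neither (states T)))))
stop-balance (other T) = trans (sum-stopAt-∷ both (states T)) (trans (cong (1ℚ +_) (stop-balance T))
  (trans (solve 1 (λ x → con 1ℚ :+ (con 0ℚ :+ x) := con 0ℚ :+ (con 1ℚ :+ x)) refl
            (Σℚ.sumFin _ (startAt (states T))))
    (cong (0ℚ +_) (sym (sum-startAt-∷ both (states T))))))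
  where open +-*-Solver
stop-balance (lower T) = trans (sum-stopAt-∷ first (states T)) (cong (0ℚ +_) (trans (stop-balance T)
  (sym (sum-startAt-∷ first (states T)))))
stop-balance (upper T) = trans (sum-stopAt-∷ second (states T)) (cong (1ℚ +_) (trans (stop-balance T)
  (sym (sum-startAt-∷ second (states T)))))

form : ∀ {n} → (Fin n → Fin n → ℚ) → Exps n → Exps n → ℚ
form {n} Ω u v = Σℚ.sumFin n λ i → Σℚ.sumFin n λ j → Ω i j * (fromℤ (lookup u i) * fromℤ (lookup v j))

form-Omega : ∀ {r} X (u v : Exps (r ℕ.+ r)) → form (Omega r X) u v ≡
  Σℚ.sumFin r (λ a → Σℚ.sumFin r λ b → X a b *
    (fromℤ (lookup u (a ↑ˡ r)) * fromℤ (lookup v (r ↑ʳ b)) - fromℤ (lookup u (r ↑ʳ a)) * fromℤ (lookup v (b ↑ˡ r))))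
form-Omega {r} X u v = begin
  form (Omega r X) u v
    ≡⟨ Σℚ.sumFin-+ r r (λ i → Σℚ.sumFin (r ℕ.+ r) (term i)) ⟩
  Σᵣ (λ a → Σℚ.sumFin (r ℕ.+ r) (term (a ↑ˡ r))) + Σᵣ (λ a → Σℚ.sumFin (r ℕ.+ r) (term (r ↑ʳ a)))
    ≡⟨ Σℚ.sum-∙ (allFin r) (λ a → Σℚ.sumFin (r ℕ.+ r) (term (a ↑ˡ r))) (λ a → Σℚ.sumFin (r ℕ.+ r) (term (r ↑ʳ a))) ⟨
  Σᵣ (λ a → Σℚ.sumFin (r ℕ.+ r) (term (a ↑ˡ r)) + Σℚ.sumFin (r ℕ.+ r) (term (r ↑ʳ a)))
    ≡⟨ Σℚ.sum-cong (allFin r) (λ a → trans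
         (cong₂ _+_ (trans (Σℚ.sumFin-+ r r (term (a ↑ˡ r)))
             (cong₂ _+_ (Σℚ.sum-ε (allFin r) (ll a)) (Σℚ.sum-cong (allFin r) (lr a))))
                    (trans (Σℚ.sumFin-+ r r (term (r ↑ʳ a)))
                        (cong₂ _+_ (Σℚ.sum-cong (allFin r) (rl a)) (Σℚ.sum-ε (allFin r) (rr a)))))
         (trans (solve 2 (λ x y → (con 0ℚ :+ x) :+ (y :+ con 0ℚ) := x :+ y) refl
                  (Σᵣ λ b → X a b * (uˡ a * vʳ b)) (Σᵣ λ b → - X a b * (uʳ a * vˡ b)))
           (trans (sym (Σℚ.sum-∙ (allFin r) (λ b → X a b * (uˡ a * vʳ b)) (λ b → - X a b * (uʳ a * vˡ b))))
             (Σℚ.sum-cong (allFin r) λ b →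
               solve 3 (λ x y z → x :* y :+ :- x :* z := x :* (y :- z)) refl (X a b) (uˡ a * vʳ b) (uʳ a * vˡ b))))) ⟩
  Σᵣ (λ a → Σᵣ λ b → X a b * (uˡ a * vʳ b - uʳ a * vˡ b)) ∎
  where
  open ≡-Reasoning
  open +-*-Solver
  Σᵣ : (Fin r → ℚ) → ℚ
  Σᵣ = Σℚ.sumFin r
  term : Fin (r ℕ.+ r) → Fin (r ℕ.+ r) → ℚ
  term i j = Omega r X i j * (fromℤ (lookup u i) * fromℤ (lookup v j))
  uˡ uʳ vˡ vʳ : Fin r → ℚ
  uˡ a = fromℤ (lookup u (a ↑ˡ r))
  uʳ a = fromℤ (lookup u (r ↑ʳ a))
  vˡ a = fromℤ (lookup v (a ↑ˡ r))
  vʳ a = fromℤ (lookup v (r ↑ʳ a))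
  ll : ∀ a b → term (a ↑ˡ r) (b ↑ˡ r) ≡ 0ℚ
  ll a b rewrite Fin.splitAt-↑ˡ r a r | Fin.splitAt-↑ˡ r b r = ℚ.*-zeroˡ (uˡ a * vˡ b)
  lr : ∀ a b → term (a ↑ˡ r) (r ↑ʳ b) ≡ X a b * (uˡ a * vʳ b)
  lr a b rewrite Fin.splitAt-↑ˡ r a r | Fin.splitAt-↑ʳ r r b = refl
  rl : ∀ a b → term (r ↑ʳ a) (b ↑ˡ r) ≡ - X a b * (uʳ a * vˡ b)
  rl a b rewrite Fin.splitAt-↑ʳ r r a | Fin.splitAt-↑ˡ r b r = refl
  rr : ∀ a b → term (r ↑ʳ a) (r ↑ʳ b) ≡ 0ℚ
  rr a b rewrite Fin.splitAt-↑ʳ r r a | Fin.splitAt-↑ʳ r r b = ℚ.*-zeroˡ (uʳ a * vʳ b)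

-- Taken for arbitrary functions of the row, so that a sum of two such vectors has the same shape
-- and a profile can serve as input.
exponents : ∀ {r} → (Fin (suc r) → ℕ) → (Fin (suc r) → ℕ) → Exps (r ℕ.+ r)
exponents {r} e f = Vec.tabulate λ i → [ (λ a → ℤ.+ e (suc a) ℤ.- ℤ.+ e (inject₁ a)) ,
                                         (λ b → ℤ.+ f (inject₁ b) ℤ.- ℤ.+ f (suc b)) ]′ (splitAt r i)

lookup-exponentsˡ : ∀ {r} e f (a : Fin r) →
  lookup (exponents e f) (a ↑ˡ r) ≡ ℤ.+ e (suc a) ℤ.- ℤ.+ e (inject₁ a)
lookup-exponentsˡ {r} e f a = trans (Vec.lookup∘tabulate _ (a ↑ˡ r)) (cong [ _ , _ ]′ (Fin.splitAt-↑ˡ r a r))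

lookup-exponentsʳ : ∀ {r} e f (b : Fin r) →
  lookup (exponents e f) (r ↑ʳ b) ≡ ℤ.+ f (inject₁ b) ℤ.- ℤ.+ f (suc b)
lookup-exponentsʳ {r} e f b = trans (Vec.lookup∘tabulate _ (r ↑ʳ b)) (cong [ _ , _ ]′ (Fin.splitAt-↑ʳ r r b))

halves-ext : ∀ {r} (u v : Exps (r ℕ.+ r)) → (∀ a → lookup u (a ↑ˡ r) ≡ lookup v (a ↑ˡ r)) →
  (∀ b → lookup u (r ↑ʳ b) ≡ lookup v (r ↑ʳ b)) → u ≡ v
halves-ext {r} u v eqˡ eqʳ = Pointwise-≡⇒≡ (ext λ i →
  subst (λ i → lookup u i ≡ lookup v i) (Fin.join-splitAt r r i) (on-join (splitAt r i)))
  where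
  on-join : ∀ s → lookup u (Fin.join r r s) ≡ lookup v (Fin.join r r s)
  on-join (inj₁ a) = eqˡ a
  on-join (inj₂ b) = eqʳ b

exponents-+ : ∀ {r} (e f e′ f′ : Fin (suc r) → ℕ) →
  zipWith ℤ._+_ (exponents e f) (exponents e′ f′) ≡ exponents (λ y → e y ℕ.+ e′ y) (λ y → f y ℕ.+ f′ y)
exponents-+ {r} e f e′ f′ = halves-ext _ _
  (λ a → trans (Vec.lookup-zipWith ℤ._+_ (a ↑ˡ r) (exponents e f) (exponents e′ f′))
    (trans (cong₂ ℤ._+_ (lookup-exponentsˡ e f a) (lookup-exponentsˡ e′ f′ a))
    (trans (rearrange (e (suc a)) (e (inject₁ a)) (e′ (suc a)) (e′ (inject₁ a)))
        (sym (lookup-exponentsˡ (λ y → e y ℕ.+ e′ y) (λ y → f y ℕ.+ f′ y) a)))))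
  (λ b → trans (Vec.lookup-zipWith ℤ._+_ (r ↑ʳ b) (exponents e f) (exponents e′ f′))
    (trans (cong₂ ℤ._+_ (lookup-exponentsʳ e f b) (lookup-exponentsʳ e′ f′ b))
    (trans (rearrange (f (inject₁ b)) (f (suc b)) (f′ (inject₁ b)) (f′ (suc b)))
        (sym (lookup-exponentsʳ (λ y → e y ℕ.+ e′ y) (λ y → f y ℕ.+ f′ y) b)))))
  where
  open ℤSolver.+-*-Solver
  rearrange : ∀ a b c d → (ℤ.+ a ℤ.- ℤ.+ b) ℤ.+ (ℤ.+ c ℤ.- ℤ.+ d) ≡ ℤ.+ (a ℕ.+ c) ℤ.- ℤ.+ (b ℕ.+ d)
  rearrange a b c d = trans
    (solve 4 (λ a b c d → (a :- b) :+ (c :- d) := (a :+ c) :- (b :+ d)) refl (ℤ.+ a) (ℤ.+ b) (ℤ.+ c) (ℤ.+ d))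
    (sym (cong₂ ℤ._-_ (ℤ.pos-+ a c) (ℤ.pos-+ b d)))

tilingExponents : ∀ {r p} → Tiling p (suc r) → Exps (r ℕ.+ r)
tilingExponents T = exponents (start ∘ lookup (states T)) (stop ∘ lookup (states T))

form-tilings : ∀ {r X} → IsCartanInverse (suc r) X → (T U : Tiling false (suc (suc r))) →
  form (Omega (suc r) X) (tilingExponents T) (tilingExponents U) ≡ cross (states T) (states U)
form-tilings {r} {X} inv T U = begin
  form (Omega (suc r) X) (tilingExponents T) (tilingExponents U)
    ≡⟨ form-Omega X (tilingExponents T) (tilingExponents U) ⟩
  _ ≡⟨ Σℚ.sum-cong bs (λ a → Σℚ.sum-cong bs λ b → cong (X a b *_)
         (cong₂ _-_ (cong₂ _*_ (coordˡ T a) (coordʳ U b)) (cong₂ _*_ (coordʳ T a) (coordˡ U b)))) ⟩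
  Σ₁ (λ a → Σ₁ λ b → X a b * (Δ e a * - Δ f′ b - - Δ f a * Δ e′ b))
    ≡⟨ Σℚ.sum-cong bs (λ a → trans (Σℚ.sum-cong bs λ b →
         solve 5 (λ x e f′ f e′ → x :* (e :* :- f′ :- :- f :* e′) := x :* (f :* e′) :- x :* (e :* f′)) refl
           (X a b) (Δ e a) (Δ f′ b) (Δ f a) (Δ e′ b))
         (sum-minus bs (λ b → X a b * (Δ f a * Δ e′ b)) (λ b → X a b * (Δ e a * Δ f′ b)))) ⟩
  Σ₁ (λ a → Σ₁ (λ b → X a b * (Δ f a * Δ e′ b)) - Σ₁ (λ b → X a b * (Δ e a * Δ f′ b)))
    ≡⟨ sum-minus bs (λ a → Σ₁ λ b → X a b * (Δ f a * Δ e′ b)) (λ a → Σ₁ λ b → X a b * (Δ e a * Δ f′ b)) ⟩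
  Σ₁ (λ a → Σ₁ λ b → X a b * (Δ f a * Δ e′ b)) - Σ₁ (λ a → Σ₁ λ b → X a b * (Δ e a * Δ f′ b))
    ≡⟨ cong₂ _-_ (inverse-form-Δ inv f e′) (inverse-form-Δ inv e f′) ⟩
  (Σ₂ (λ y → f y * e′ y) + κ * (Σ₂ f * Σ₂ e′)) - (Σ₂ (λ y → e y * f′ y) + κ * (Σ₂ e * Σ₂ f′))
    ≡⟨ cong₂ (λ x y → (Σ₂ (λ y → f y * e′ y) + κ * (x * Σ₂ e′)) - (Σ₂ (λ y → e y * f′ y) + κ * (Σ₂ e * y)))
         (trans (stop-balance T) (ℚ.+-identityˡ (Σ₂ e))) (trans (stop-balance U) (ℚ.+-identityˡ (Σ₂ e′))) ⟩
  (Σ₂ (λ y → f y * e′ y) + κ * (Σ₂ e * Σ₂ e′)) - (Σ₂ (λ y → e y * f′ y) + κ * (Σ₂ e * Σ₂ e′))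
    ≡⟨ solve 3 (λ x y z → (x :+ z) :- (y :+ z) := x :- y) refl
         (Σ₂ λ y → f y * e′ y) (Σ₂ λ y → e y * f′ y) (κ * (Σ₂ e * Σ₂ e′)) ⟩
  Σ₂ (λ y → f y * e′ y) - Σ₂ (λ y → e y * f′ y)
    ≡⟨ sum-minus (allFin (suc (suc r))) (λ y → f y * e′ y) (λ y → e y * f′ y) ⟨
  Σ₂ (λ y → f y * e′ y - e y * f′ y)
    ≡⟨ cross-sum (states T) (states U) ⟨
  cross (states T) (states U) ∎
  where
  open ≡-Reasoning
  open +-*-Solver
  bs : List (Fin (suc r))
  bs = allFin (suc r)
  Σ₁ : (Fin (suc r) → ℚ) → ℚ
  Σ₁ = Σℚ.sumFin (suc r)
  Σ₂ : (Fin (suc (suc r)) → ℚ) → ℚ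
  Σ₂ = Σℚ.sumFin (suc (suc r))
  κ : ℚ
  κ = X (fromℕ r) (fromℕ r) - 1ℚ
  e f e′ f′ : Fin (suc (suc r)) → ℚ
  e = startAt (states T)
  f = stopAt (states T)
  e′ = startAt (states U)
  f′ = stopAt (states U)
  coordˡ : ∀ (T : Tiling false (suc (suc r))) a →
    fromℤ (lookup (tilingExponents T) (a ↑ˡ suc r)) ≡ Δ (startAt (states T)) a
  coordˡ T a = trans (cong fromℤ (lookup-exponentsˡ (start ∘ lookup (states T)) (stop ∘ lookup (states T)) a))
    (fromℤ-minus (ℤ.+ start (lookup (states T) (suc a))) (ℤ.+ start (lookup (states T) (inject₁ a))))
  coordʳ : ∀ (T : Tiling false (suc (suc r))) b →
    fromℤ (lookup (tilingExponents T) (suc r ↑ʳ b)) ≡ - Δ (stopAt (states T)) b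
  coordʳ T b = trans (cong fromℤ (lookup-exponentsʳ (start ∘ lookup (states T)) (stop ∘ lookup (states T)) b)) (trans
    (fromℤ-minus (ℤ.+ stop (lookup (states T) (inject₁ b))) (ℤ.+ stop (lookup (states T) (suc b))))
    (solve 2 (λ x y → x :- y := :- (y :- x)) refl (stopAt (states T) (inject₁ b)) (stopAt (states T) (suc b))))

-- Perfect matchings as tilings

module _ {A : Set} where

  where-true : (A → Bool) → List A → List A
  where-true χ = filter (λ x → χ x Bool.≟ true)

  where-true-cong : ∀ {χ ψ : A → Bool} {xs} → All (λ x → χ x ≡ ψ x) xs → where-true χ xs ≡ where-true ψ xs
  where-true-cong                        []                = refl
  where-true-cong {χ} {ψ} {x ∷ xs} (eq ∷ eqs) rewrite eq with ψ x
  ... | true  = cong (x ∷_) (where-true-cong eqs)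
  ... | false = where-true-cong eqs

  where-true-∷-true : ∀ {χ : A → Bool} {x} xs → χ x ≡ true → where-true χ (x ∷ xs) ≡ x ∷ where-true χ xs
  where-true-∷-true xs eq rewrite eq = refl

  where-true-∷-false : ∀ {χ : A → Bool} {x} xs → χ x ≡ false → where-true χ (x ∷ xs) ≡ where-true χ xs
  where-true-∷-false xs eq rewrite eq = refl

  where-true∈sublists : ∀ (χ : A → Bool) xs → where-true χ xs ∈ sublists xs
  where-true∈sublists χ []       = here refl
  where-true∈sublists χ (x ∷ xs) with χ x
  ... | true  = ∈-++⁺ˡ (∈-map⁺ (x ∷_) (where-true∈sublists χ xs))
  ... | false = ∈-++⁺ʳ (map (x ∷_) (sublists xs)) (where-true∈sublists χ xs)

  ∷∈sublists⇒∈ : ∀ {x : A} {M} xs → x ∷ M ∈ sublists xs → x ∈ xs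
  ∷∈sublists⇒∈ []       (here ())
  ∷∈sublists⇒∈ []       (there ())
  ∷∈sublists⇒∈ (y ∷ xs) p with ∈-++⁻ (map (y ∷_) (sublists xs)) p
  ... | inj₂ q = there (∷∈sublists⇒∈ xs q)
  ... | inj₁ q with ∈-map⁻ (y ∷_) q
  ...   | _ , _ , refl = here refl

  sublists-unique : ∀ {xs : List A} → Unique xs → Unique (sublists xs)
  sublists-unique []                       = [] ∷ []
  sublists-unique {x ∷ xs} (x∉xs ∷ unique) =
    Unique.++⁺ (Unique.map⁺ (λ { refl → refl }) (sublists-unique unique)) (sublists-unique unique) disjoint
    where
    disjoint : Disjoint (map (x ∷_) (sublists xs)) (sublists xs)
    disjoint (p , q) with ∈-map⁻ (x ∷_) p
    ... | _ , _ , refl = All.lookup x∉xs (∷∈sublists⇒∈ xs q) refl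

  module _ (_≟_ : DecidableEquality A) where

    override : A → Bool → (A → Bool) → A → Bool
    override x b χ y = if does (y ≟ x) then b else χ y

    override-≡ : ∀ x b χ → override x b χ x ≡ b
    override-≡ x b χ with x ≟ x
    ... | yes _  = refl
    ... | no x≢x = ⊥-elim (x≢x refl)

    override-≢ : ∀ x b χ {y} → x ≢ y → override x b χ y ≡ χ y
    override-≢ x b χ {y} x≢y with y ≟ x
    ... | yes y≡x = ⊥-elim (x≢y (sym y≡x))
    ... | no _    = refl

    -- Sublists of a duplicate-free list have characteristic functions: `override` sets the value at
    -- the head, and since the head does not recur, the tail is unaffected.
    sublists⁻ : ∀ {xs M} → Unique xs → M ∈ sublists xs → ∃[ χ ] M ≡ where-true χ xs
    sublists⁻ {[]}     []              (here refl) = (λ _ → true) , refl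
    sublists⁻ {x ∷ xs} (x∉xs ∷ unique) p with ∈-++⁻ (map (x ∷_) (sublists xs)) p
    ... | inj₂ q = let χ , eq = sublists⁻ unique q in
      override x false χ , trans eq (sym (trans
        (where-true-∷-false {override x false χ} xs (override-≡ x false χ))
        (where-true-cong (All.map (override-≢ x false χ) x∉xs))))
    ... | inj₁ q with ∈-map⁻ (x ∷_) q
    ...   | M , r , refl = let χ , eq = sublists⁻ unique r in
      override x true χ , trans (cong (x ∷_) eq) (sym (trans
        (where-true-∷-true {override x true χ} xs (override-≡ x true χ))
        (cong (x ∷_) (where-true-cong (All.map (override-≢ x true χ) x∉xs)))))

and-true⁻ : ∀ {A : Set} (p : A → Bool) {xs x} → and (map p xs) ≡ true → x ∈ xs → p x ≡ true
and-true⁻ p {y ∷ xs} eq x∈ with p y in py | x∈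
... | true | here refl = py
... | true | there x∈xs = and-true⁻ p eq x∈xs

and-true⁺ : ∀ {A : Set} (p : A → Bool) xs → (∀ x → p x ≡ true) → and (map p xs) ≡ true
and-true⁺ p []       eq = refl
and-true⁺ p (x ∷ xs) eq rewrite eq x = and-true⁺ p xs eq

does-≟⇒≡ : ∀ {n} {i j : Fin n} → does (i Fin.≟ j) ≡ true → i ≡ j
does-≟⇒≡ {i = i} {j} eq with i Fin.≟ j
... | yes i≡j = i≡j

edgeEq-refl : ∀ {r} (e : Edge r) → edgeEq e e ≡ true
edgeEq-refl (hor c y) = cong₂ _∧_ (dec-true (c Fin.≟ c) refl) (dec-true (y Fin.≟ y) refl)
edgeEq-refl (ver x y) = cong₂ _∧_ (dec-true (x Fin.≟ x) refl) (dec-true (y Fin.≟ y) refl)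

edgeEq⇒≡ : ∀ {r} (e e′ : Edge r) → edgeEq e e′ ≡ true → e ≡ e′
edgeEq⇒≡ (hor c y) (hor c′ y′) eq = cong₂ hor (does-≟⇒≡ (Bool.∧-conicalˡ _ _ eq)) (does-≟⇒≡ (Bool.∧-conicalʳ _ _ eq))
edgeEq⇒≡ (ver x y) (ver x′ y′) eq = cong₂ ver (does-≟⇒≡ (Bool.∧-conicalˡ _ _ eq)) (does-≟⇒≡ (Bool.∧-conicalʳ _ _ eq))

_≟ᴱ_ : ∀ {r} → DecidableEquality (Edge r)
e ≟ᴱ e′ with edgeEq e e′ in eq
... | true  = yes (edgeEq⇒≡ e e′ eq)
... | false = no λ { refl → case (trans (sym (edgeEq-refl e)) eq) }
  where
  case : true ≢ false
  case ()

∈-allEdges : ∀ {r} (e : Edge r) → e ∈ allEdges r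
∈-allEdges {r} (hor zero y)       = ∈-++⁺ˡ (∈-++⁺ˡ (∈-map⁺ (hor zero) (∈-allFin y)))
∈-allEdges {r} (hor (suc zero) y) =
  ∈-++⁺ˡ (∈-++⁺ʳ (map (hor zero) (allFin (suc r))) (∈-++⁺ˡ (∈-map⁺ (hor (suc zero)) (∈-allFin y))))
∈-allEdges {r} (ver zero y)       =
  ∈-++⁺ʳ (concatMap (λ c → map (hor c) (allFin (suc r))) (allFin 2)) (∈-++⁺ˡ (∈-map⁺ (ver zero) (∈-allFin y)))
∈-allEdges {r} (ver (suc zero) y) =
  ∈-++⁺ʳ (concatMap (λ c → map (hor c) (allFin (suc r))) (allFin 2))
    (∈-++⁺ʳ (map (ver zero) (allFin r)) (∈-++⁺ˡ (∈-map⁺ (ver (suc zero)) (∈-allFin y))))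

two-columns-unique : ∀ {A B : Set} {xs : List A} (f : Fin 2 → A → B) →
  (∀ {c d x y} → f c x ≡ f d y → c ≡ d × x ≡ y) → Unique xs →
  Unique (concatMap (λ c → map (f c) xs) (allFin 2))
two-columns-unique {xs = xs} f injective unique =
  Unique.++⁺ (Unique.map⁺ (proj₂ ∘ injective) unique)
    (Unique.++⁺ (Unique.map⁺ (proj₂ ∘ injective) unique) [] (λ { (_ , ()) })) disjoint
  where
  disjoint : Disjoint (map (f zero) xs) (map (f (suc zero)) xs ++ [])
  disjoint (p , q) with ∈-map⁻ (f zero) p | ∈-++⁻ (map (f (suc zero)) xs) q
  ... | _ , _ , refl | inj₁ q′ with ∈-map⁻ (f (suc zero)) q′
  ...   | _ , _ , eq with injective eq
  ...     | () , _

hor∉vers : ∀ {r c y} x (ys : List (Fin r)) → hor c y ∉ map (ver x) ys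
hor∉vers x (_ ∷ ys) (there p) = hor∉vers x ys p

allEdges-unique : ∀ r → Unique (allEdges r)
allEdges-unique r = Unique.++⁺
  (two-columns-unique hor (λ { refl → refl , refl }) (Unique.allFin⁺ (suc r)))
  (two-columns-unique ver (λ { refl → refl , refl }) (Unique.allFin⁺ r))
  disjoint
  where
  ver∉hors : ∀ {x y} c (ys : List (Fin (suc r))) → ver {r} x y ∉ map (hor c) ys
  ver∉hors c (_ ∷ ys) (there p) = ver∉hors c ys p
  disjoint : Disjoint (concatMap (λ c → map (hor {r} c) (allFin (suc r))) (allFin 2))
                      (concatMap (λ x → map (ver x) (allFin r)) (allFin 2))
  disjoint {ver x y} (p , _) with ∈-++⁻ (map (hor zero) (allFin (suc r))) p
  ... | inj₁ q = ver∉hors zero _ q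
  ... | inj₂ q with ∈-++⁻ (map (hor (suc zero)) (allFin (suc r))) q
  ...   | inj₁ q′ = ver∉hors (suc zero) _ q′
  disjoint {hor c y} (_ , p) with ∈-++⁻ (map (ver zero) (allFin r)) p
  ... | inj₁ q = hor∉vers zero _ q
  ... | inj₂ q with ∈-++⁻ (map (ver (suc zero)) (allFin r)) q
  ...   | inj₁ q′ = hor∉vers (suc zero) _ q′

-- Sums over sets of edges and degrees of vertices

module EdgeSum {A : Set} {_∙_ : A → A → A} {ε : A} (isCM : IsCommutativeMonoid _≡_ _∙_ ε) where
  open Summation isCM

  sum-select : ∀ {r} (χ : Edge r → Bool) (φ : Edge r → A) →
    sum (where-true χ (allEdges r)) φ ≡
    sumFin 2 (λ c → sumFin (suc r) λ y → if χ (hor c y) then φ (hor c y) else ε) ∙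
    sumFin 2 (λ x → sumFin r λ y → if χ (ver x y) then φ (ver x y) else ε)
  sum-select {r} χ φ = trans (sum-filter χ (allEdges r) φ)
    (trans (sum-++ (concatMap (λ c → map (hor c) (allFin (suc r))) (allFin 2)) _ term)
      (cong₂ _∙_
        (trans (sum-concatMap (λ c → map (hor c) (allFin (suc r))) (allFin 2) term)
          (sum-cong (allFin 2) λ c → sum-map (hor c) (allFin (suc r)) term))
        (trans (sum-concatMap (λ x → map (ver x) (allFin r)) (allFin 2) term)
          (sum-cong (allFin 2) λ x → sum-map (ver x) (allFin r) term))))
    where
    term : Edge r → A
    term e = if χ e then φ e else ε

module Σℕ = Summation ℕ.+-0-isCommutativeMonoid
module ℕEdgeSum = EdgeSum ℕ.+-0-isCommutativeMonoid

count-sum : ∀ {A : Set} (p : A → Bool) xs → count p xs ≡ Σℕ.sum xs (λ x → if p x then 1 else 0)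
count-sum p []       = refl
count-sum p (x ∷ xs) with p x
... | true  = cong suc (count-sum p xs)
... | false = count-sum p xs

indicator : Bool → ℕ
indicator b = if b then 1 else 0

above : ∀ {r} → (Fin r → Bool) → Fin (suc r) → Bool
above {zero}  g zero    = false
above {suc r} g zero    = g zero
above {suc r} g (suc y) = above (g ∘ suc) y

-- The flag `p` stands for an edge entering the lowest row from outside, as happens once lower rows
-- have been stripped.
below : ∀ {r} → Bool → (Fin r → Bool) → Fin (suc r) → Bool
below p g zero    = p
below p g (suc y) = g y

above-cong : ∀ {r} {g h : Fin r → Bool} → (∀ y → g y ≡ h y) → ∀ y → above g y ≡ above h y
above-cong {zero}  eq zero    = refl
above-cong {suc r} eq zero    = eq zero
above-cong {suc r} eq (suc y) = above-cong (eq ∘ suc) y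

sum-vertical : ∀ {r} (g : Fin r → Bool) (y : Fin (suc r)) →
  Σℕ.sumFin r (λ y′ → if g y′ then indicator ((toℕ y ≡ᵇ toℕ y′) ∨ (toℕ y ≡ᵇ suc (toℕ y′))) else 0) ≡
  indicator (above g y) ℕ.+ indicator (below false g y)
sum-vertical {zero}  g zero    = refl
sum-vertical {suc r} g zero    = trans (Σℕ.sumFin-suc λ y′ → if g y′ then indicator
    ((0 ≡ᵇ toℕ y′) ∨ (0 ≡ᵇ suc (toℕ y′))) else 0)
  (cong (indicator (g zero) ℕ.+_) (Σℕ.sum-ε (allFin r) λ y′ → Bool.if-eta (g (suc y′))))
sum-vertical {suc r} g (suc y) = trans
  (Σℕ.sumFin-suc λ y′ → if g y′ then indicator ((suc (toℕ y) ≡ᵇ toℕ y′) ∨ (suc (toℕ y) ≡ᵇ suc (toℕ y′))) else 0)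
  (trans (cong₂ ℕ._+_ (refl {x = first-term}) (sum-vertical (g ∘ suc) y)) (split y))
  where
  first-term : ℕ
  first-term = if g zero then indicator (toℕ y ≡ᵇ 0) else 0
  split : ∀ y → (if g zero then indicator (toℕ y ≡ᵇ 0) else 0) ℕ.+
    (indicator (above (g ∘ suc) y) ℕ.+ indicator (below false (g ∘ suc) y)) ≡
    indicator (above (g ∘ suc) y) ℕ.+ indicator (g y)
  split zero    = trans (cong (indicator (g zero) ℕ.+_) (ℕ.+-identityʳ (indicator (above (g ∘ suc) zero))))
    (ℕ.+-comm (indicator (g zero)) (indicator (above (g ∘ suc) zero)))
  split (suc y) = cong (ℕ._+ (indicator (above (g ∘ suc) (suc y)) ℕ.+ indicator (g (suc y)))) (Bool.if-eta (g zero))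

does-≟-≡ᵇ : ∀ {n} (i j : Fin n) → does (i Fin.≟ j) ≡ (toℕ i ≡ᵇ toℕ j)
does-≟-≡ᵇ zero    zero    = refl
does-≟-≡ᵇ zero    (suc j) = refl
does-≟-≡ᵇ (suc i) zero    = refl
does-≟-≡ᵇ (suc i) (suc j) = does-≟-≡ᵇ i j

sum-row : ∀ {n} (g : Fin n → Bool) (y : Fin n) →
  Σℕ.sumFin n (λ y′ → if g y′ then indicator (toℕ y ≡ᵇ toℕ y′) else 0) ≡ indicator (g y)
sum-row {n} g y = trans
  (Σℕ.sumFin-single y {f = λ y′ → if g y′ then indicator (toℕ y ≡ᵇ toℕ y′) else 0} λ y′ y′≢y →
    trans (cong (λ b → if g y′ then indicator b else 0) (dec-false (toℕ y ℕ.≟ toℕ y′)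
        (y′≢y ∘ sym ∘ Fin.toℕ-injective))) (Bool.if-eta (g y′)))
  (cong (λ b → if g y then indicator b else 0) (dec-true (toℕ y ℕ.≟ toℕ y) refl))

-- Circumference two: each horizontal edge of a row ends at both vertices of that row, so the
-- columns drop out.
incident-hor : ∀ {r} x (y : Fin (suc r)) c y′ → incident {r} (x , y) (hor c y′) ≡ (toℕ y ≡ᵇ toℕ y′)
incident-hor zero       y zero       y′ = Bool.∨-identityʳ _
incident-hor zero       y (suc zero) y′ = refl
incident-hor (suc zero) y zero       y′ = refl
incident-hor (suc zero) y (suc zero) y′ = Bool.∨-identityʳ _

degree : ∀ {r} (χ : Edge r → Bool) x (y : Fin (suc r)) →
  count (incident (x , y)) (where-true χ (allEdges r)) ≡
  (indicator (χ (hor zero y)) ℕ.+ indicator (χ (hor (suc zero) y))) ℕ.+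
  (indicator (above (χ ∘ ver x) y) ℕ.+ indicator (below false (χ ∘ ver x) y))
degree {r} χ x y = begin
  count (incident (x , y)) (where-true χ (allEdges r))
    ≡⟨ count-sum (incident (x , y)) (where-true χ (allEdges r)) ⟩
  Σℕ.sum (where-true χ (allEdges r)) (λ e → indicator (incident (x , y) e))
    ≡⟨ ℕEdgeSum.sum-select χ (λ e → indicator (incident (x , y) e)) ⟩
  (horizontal zero ℕ.+ (horizontal (suc zero) ℕ.+ 0)) ℕ.+ (vertical zero ℕ.+ (vertical (suc zero) ℕ.+ 0))
    ≡⟨ cong₂ ℕ._+_ (cong₂ ℕ._+_ (horizontal-sum zero) (trans (ℕ.+-identityʳ _) (horizontal-sum (suc zero))))
        (vertical-sum x refl) ⟩
  _ ∎
  where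
  open ≡-Reasoning
  horizontal vertical : Fin 2 → ℕ
  horizontal c = Σℕ.sumFin (suc r) λ y′ → if χ (hor c y′) then indicator (incident (x , y) (hor c y′)) else 0
  vertical x′ = Σℕ.sumFin r λ y′ → if χ (ver x′ y′) then indicator (incident (x , y) (ver x′ y′)) else 0
  horizontal-sum : ∀ c → horizontal c ≡ indicator (χ (hor c y))
  horizontal-sum c = trans
    (Σℕ.sum-cong (allFin (suc r)) λ y′ → cong (λ b → if χ (hor c y′) then indicator b else 0) (incident-hor x y c y′))
    (sum-row (χ ∘ hor c) y)
  same : ∀ z → Σℕ.sumFin r (λ y′ → if χ (ver z y′) then
      indicator ((toℕ y ≡ᵇ toℕ (inject₁ y′)) ∨ (toℕ y ≡ᵇ suc (toℕ y′))) else 0) ≡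
    indicator (above (χ ∘ ver z) y) ℕ.+ indicator (below false (χ ∘ ver z) y)
  same z = trans (Σℕ.sum-cong (allFin r) λ y′ →
      cong (λ k → if χ (ver z y′) then indicator ((toℕ y ≡ᵇ k) ∨ (toℕ y ≡ᵇ suc (toℕ y′))) else 0)
          (Fin.toℕ-inject₁ y′))
    (sum-vertical (χ ∘ ver z) y)
  none : ∀ z → Σℕ.sumFin r (λ y′ → if χ (ver z y′) then 0 else 0) ≡ 0
  none z = Σℕ.sum-ε (allFin r) λ y′ → Bool.if-eta (χ (ver z y′))
  vertical-sum : ∀ z → z ≡ x → vertical zero ℕ.+ (vertical (suc zero) ℕ.+ 0) ≡
    indicator (above (χ ∘ ver x) y) ℕ.+ indicator (below false (χ ∘ ver x) y)
  vertical-sum zero refl = trans (cong₂ ℕ._+_ (same zero) (trans (ℕ.+-identityʳ _) (none (suc zero))))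
      (ℕ.+-identityʳ _)
  vertical-sum (suc zero) refl = trans (cong₂ ℕ._+_ (none zero) (ℕ.+-identityʳ _)) (same (suc zero))

allVertices-∈ : ∀ {r} (v : Vertex r) → v ∈ allVertices r
allVertices-∈ {r} (zero , y)     = ∈-++⁺ˡ (∈-map⁺ (zero ,_) (∈-allFin y))
allVertices-∈ {r} (suc zero , y) =
  ∈-++⁺ʳ (map (zero ,_) (allFin (suc r))) (∈-++⁺ˡ (∈-map⁺ (suc zero ,_) (∈-allFin y)))

-- The perfect matching of a tiling

isBase isOther isLower isUpper : State → Bool
isBase neither = true
isBase _       = false
isOther both = true
isOther _    = false
isLower first = true
isLower _     = false
isUpper second = true
isUpper _      = false

stateAt : ∀ {p n} → Tiling p n → Fin n → State
stateAt T y = lookup (states T) y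

-- The edge of `M₀` in a row is the one with black left endpoint, so `isBase` decides about it and
-- `isOther` about its companion. A pair of vertical edges is read off its lower row.
occupied : ∀ {r} → Tiling false (suc r) → Edge r → Bool
occupied T (hor c y) = if black (c , y) then isBase (stateAt T y) else isOther (stateAt T y)
occupied T (ver x y) = isLower (stateAt T (inject₁ y))

matching : ∀ {r} → Tiling false (suc r) → List (Edge r)
matching {r} T = where-true (occupied T) (allEdges r)

-- In the top row both sides are false: `lower` would require an element of the empty type
-- `Tiling true 0`.
above-isLower : ∀ {p r} (T : Tiling p (suc r)) y → above (λ y′ → isLower (stateAt T (inject₁ y′))) y ≡ isLower
    (stateAt T y)
above-isLower {r = zero}  (base [])  zero = refl
above-isLower {r = zero}  (other []) zero = refl
above-isLower {r = zero}  (upper []) zero = refl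
above-isLower {r = zero}  (lower ()) zero
above-isLower {r = suc r} T zero = refl
above-isLower {r = suc r} (base T)  (suc y) = above-isLower T y
above-isLower {r = suc r} (other T) (suc y) = above-isLower T y
above-isLower {r = suc r} (lower T) (suc y) = above-isLower T y
above-isLower {r = suc r} (upper T) (suc y) = above-isLower T y

isUpper-zero : ∀ {p r} (T : Tiling p (suc r)) → isUpper (stateAt T zero) ≡ p
isUpper-zero (base T)  = refl
isUpper-zero (other T) = refl
isUpper-zero (lower T) = refl
isUpper-zero (upper T) = refl

isUpper-suc : ∀ {p r} (T : Tiling p (suc r)) a → isUpper (stateAt T (suc a)) ≡ isLower (stateAt T (inject₁ a))
isUpper-suc (base T)  zero    = isUpper-zero T
isUpper-suc (other T) zero    = isUpper-zero T
isUpper-suc (lower T) zero    = isUpper-zero T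
isUpper-suc (upper T) zero    = isUpper-zero T
isUpper-suc (base T)  (suc a) = isUpper-suc T a
isUpper-suc (other T) (suc a) = isUpper-suc T a
isUpper-suc (lower T) (suc a) = isUpper-suc T a
isUpper-suc (upper T) (suc a) = isUpper-suc T a

below-isLower : ∀ {p r} (T : Tiling p (suc r)) y → below p (λ y′ → isLower (stateAt T (inject₁ y′))) y ≡ isUpper
    (stateAt T y)
below-isLower T zero    = sym (isUpper-zero T)
below-isLower T (suc y) = sym (isUpper-suc T y)

matching-perfect : ∀ {r} (T : Tiling false (suc r)) → isPerfectMatching (matching T) ≡ true
matching-perfect {r} T = and-true⁺ (λ v → count (incident v) (matching T) ≡ᵇ 1) (allVertices r) λ { (x , y) →
  cong (_≡ᵇ 1) (trans (degree (occupied T) x y) (trans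
    (cong₂ (λ a b → horizontal y ℕ.+ (indicator a ℕ.+ indicator b)) (above-isLower T y) (below-isLower T y))
    (degree-one (odd (toℕ y)) (stateAt T y)))) }
  where
  horizontal : Fin (suc r) → ℕ
  horizontal y = indicator (occupied T (hor zero y)) ℕ.+ indicator (occupied T (hor (suc zero) y))
  degree-one : ∀ o s →
    (indicator (if o then isBase s else isOther s) ℕ.+ indicator (if not o then isBase s else isOther s)) ℕ.+
    (indicator (isLower s) ℕ.+ indicator (isUpper s)) ≡ 1
  degree-one true  neither = refl
  degree-one true  both    = refl
  degree-one true  first   = refl
  degree-one true  second  = refl
  degree-one false neither = refl
  degree-one false both    = refl
  degree-one false first   = refl
  degree-one false second  = refl

-- The tiling of a perfect matching

rowState : ∀ {a b g h p : Bool} →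
  (indicator a ℕ.+ indicator b) ℕ.+ (indicator g ℕ.+ indicator p) ≡ 1 →
  (indicator a ℕ.+ indicator b) ℕ.+ (indicator h ℕ.+ indicator p) ≡ 1 →
  g ≡ h × (p ≡ true × (a ≡ false × b ≡ false × g ≡ false) ⊎ p ≡ false × (
    (a ≡ true × b ≡ false × g ≡ false) ⊎ (a ≡ false × b ≡ true × g ≡ false) ⊎ (a ≡ false × b ≡ false × g ≡ true)))
rowState {false} {false} {false} {false} {true}  _ _ = refl , inj₁ (refl , refl , refl , refl)
rowState {true}  {false} {false} {false} {false} _ _ = refl , inj₂ (refl , inj₁ (refl , refl , refl))
rowState {false} {true}  {false} {false} {false} _ _ = refl , inj₂ (refl , inj₂ (inj₁ (refl , refl , refl)))
rowState {false} {false} {true}  {true}  {false} _ _ = refl , inj₂ (refl , inj₂ (inj₂ (refl , refl , refl)))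

RowConditions : ∀ {r} → Bool → (a b : Fin (suc r) → Bool) → (g : Fin r → Bool) → Set
RowConditions p a b g = ∀ y →
  (indicator (a y) ℕ.+ indicator (b y)) ℕ.+ (indicator (above g y) ℕ.+ indicator (below p g y)) ≡ 1

record Encodes {p r} (T : Tiling p (suc r)) (a b : Fin (suc r) → Bool) (g h : Fin r → Bool) : Set where
  field
    base≡  : ∀ y → a y ≡ isBase (stateAt T y)
    other≡ : ∀ y → b y ≡ isOther (stateAt T y)
    lower≡ : ∀ y → g y ≡ isLower (stateAt T (inject₁ y)) × h y ≡ isLower (stateAt T (inject₁ y))

-- Work upwards from the bottom row. Both vertices of a row see the same horizontal edges and, by
-- the rows already treated, the same flag `p` from below. Degree one at both then forces equal
-- vertical edges above, and exactly one state fits the row.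
decode : ∀ {r} p (a b : Fin (suc r) → Bool) (g h : Fin r → Bool) →
  RowConditions p a b g → RowConditions p a b h → Σ[ T ∈ Tiling p (suc r) ] Encodes T a b g h
decode {zero} p a b g h cg ch with rowState {a zero} {b zero} {false} {false} {p} (cg zero) (ch zero)
... | _ , inj₁ (refl , a₀ , b₀ , _) = upper [] , record
  { base≡ = λ { zero → a₀ } ; other≡ = λ { zero → b₀ } ; lower≡ = λ () }
... | _ , inj₂ (refl , inj₁ (a₀ , b₀ , _)) = base [] , record
  { base≡ = λ { zero → a₀ } ; other≡ = λ { zero → b₀ } ; lower≡ = λ () }
... | _ , inj₂ (refl , inj₂ (inj₁ (a₀ , b₀ , _))) = other [] , record
  { base≡ = λ { zero → a₀ } ; other≡ = λ { zero → b₀ } ; lower≡ = λ () }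
decode {suc r} p a b g h cg ch with rowState {a zero} {b zero} {g zero} {h zero} {p} (cg zero) (ch zero)
... | g≡h , cases = extend cases
  where
  shift : ∀ q f → RowConditions p a b f → f zero ≡ q → RowConditions q (a ∘ suc) (b ∘ suc) (f ∘ suc)
  shift q f cf eq zero    = subst (λ z → (indicator (a (suc zero)) ℕ.+ indicator (b (suc zero))) ℕ.+
    (indicator (above (f ∘ suc) zero) ℕ.+ indicator z) ≡ 1) eq (cf (suc zero))
  shift q f cf eq (suc y) = cf (suc (suc y))

  rest : ∀ q → g zero ≡ q → Σ[ T ∈ Tiling q (suc r) ] Encodes T (a ∘ suc) (b ∘ suc) (g ∘ suc) (h ∘ suc)
  rest q eq = decode q (a ∘ suc) (b ∘ suc) (g ∘ suc) (h ∘ suc) (shift q g cg eq) (shift q h ch (trans (sym g≡h) eq))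

  cons : ∀ {s} → a zero ≡ isBase s → b zero ≡ isOther s → g zero ≡ isLower s →
    ∀ {q} (T : Tiling q (suc r)) (U : Tiling p (suc (suc r))) → states U ≡ s ∷ states T →
    Encodes T (a ∘ suc) (b ∘ suc) (g ∘ suc) (h ∘ suc) → Encodes U a b g h
  cons {s} a₀ b₀ g₀ T U eq enc = record
    { base≡  = λ { zero → trans a₀ (at isBase zero) ; (suc y) → trans (Encodes.base≡ enc y) (at isBase (suc y)) }
    ; other≡ = λ { zero → trans b₀ (at isOther zero) ; (suc y) → trans (Encodes.other≡ enc y) (at isOther (suc y)) }
    ; lower≡ = λ { zero → trans g₀ (at isLower zero) , trans (trans (sym g≡h) g₀) (at isLower zero)
                 ; (suc y) → trans (proj₁ (Encodes.lower≡ enc y)) (at isLower (suc (inject₁ y)))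
                           , trans (proj₂ (Encodes.lower≡ enc y)) (at isLower (suc (inject₁ y))) }
    }
    where
    at : ∀ (f : State → Bool) y → f (lookup (s ∷ states T) y) ≡ f (stateAt U y)
    at f y = cong (λ ss → f (lookup ss y)) (sym eq)

  extend : p ≡ true × (a zero ≡ false × b zero ≡ false × g zero ≡ false) ⊎ p ≡ false × (
    (a zero ≡ true × b zero ≡ false × g zero ≡ false) ⊎ (a zero ≡ false × b zero ≡ true × g zero ≡ false) ⊎
    (a zero ≡ false × b zero ≡ false × g zero ≡ true)) → Σ[ T ∈ Tiling p (suc (suc r)) ] Encodes T a b g h
  extend (inj₁ (refl , a₀ , b₀ , g₀)) = let T , enc = rest false g₀ in upper T , cons a₀ b₀ g₀ T (upper T) refl enc
  extend (inj₂ (refl , inj₁ (a₀ , b₀ , g₀))) = let T , enc = rest false g₀ in base T , cons a₀ b₀ g₀ T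
      (base T) refl enc
  extend (inj₂ (refl , inj₂ (inj₁ (a₀ , b₀ , g₀)))) = let T , enc = rest false g₀ in other T , cons a₀ b₀ g₀ T
      (other T) refl enc
  extend (inj₂ (refl , inj₂ (inj₂ (a₀ , b₀ , g₀)))) = let T , enc = rest true g₀ in lower T , cons a₀ b₀ g₀ T
      (lower T) refl enc

perfect⇒matching : ∀ {r} (χ : Edge r → Bool) → isPerfectMatching (where-true χ (allEdges r)) ≡ true →
  ∃[ T ] where-true χ (allEdges r) ≡ matching T
perfect⇒matching {r} χ perfect = T , where-true-cong (All.tabulate λ {e} _ → χ≡occupied e)
  where
  -- `a` is the edge of `M₀` in its row and `b` its companion; in odd rows the edge of `M₀` lies in
  -- column 0.
  a b : Fin (suc r) → Bool
  a y = if odd (toℕ y) then χ (hor zero y) else χ (hor (suc zero) y)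
  b y = if odd (toℕ y) then χ (hor (suc zero) y) else χ (hor zero y)

  a+b : ∀ o u v → indicator (if o then u else v) ℕ.+ indicator (if o then v else u) ≡ indicator u ℕ.+ indicator v
  a+b true  u v = refl
  a+b false u v = ℕ.+-comm (indicator v) (indicator u)

  rows : ∀ x → RowConditions false a b (χ ∘ ver x)
  rows x y = trans
    (cong (ℕ._+ (indicator (above (χ ∘ ver x) y) ℕ.+ indicator (below false (χ ∘ ver x) y)))
      (a+b (odd (toℕ y)) (χ (hor zero y)) (χ (hor (suc zero) y))))
    (trans (sym (degree χ x y)) (ℕ.≡ᵇ⇒≡ _ 1 (subst Bool.T (sym
      (and-true⁻ (λ v → count (incident v) (where-true χ (allEdges r)) ≡ᵇ 1) perfect (allVertices-∈ (x , y)))) _)))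

  decoded : Σ[ T ∈ Tiling false (suc r) ] Encodes T a b (χ ∘ ver zero) (χ ∘ ver (suc zero))
  decoded = decode false a b (χ ∘ ver zero) (χ ∘ ver (suc zero)) (rows zero) (rows (suc zero))

  T : Tiling false (suc r)
  T = proj₁ decoded
  open Encodes (proj₂ decoded)

  pick : ∀ o {u v s} → (if o then u else v) ≡ isBase s → (if o then v else u) ≡ isOther s →
    u ≡ (if o then isBase s else isOther s) × v ≡ (if not o then isBase s else isOther s)
  pick true  p q = p , q
  pick false p q = q , p

  χ≡occupied : ∀ e → χ e ≡ occupied T e
  χ≡occupied (hor zero y)       = proj₁ (pick (odd (toℕ y)) (base≡ y) (other≡ y))
  χ≡occupied (hor (suc zero) y) = proj₂ (pick (odd (toℕ y)) (base≡ y) (other≡ y))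
  χ≡occupied (ver zero y)       = proj₁ (lower≡ y)
  χ≡occupied (ver (suc zero) y) = proj₂ (lower≡ y)

states-injective : ∀ {p n} {T U : Tiling p n} → states T ≡ states U → T ≡ U
states-injective {T = []}      {[]}      eq = refl
states-injective {T = base T}  {base U}  eq = cong base (states-injective (cong Vec.tail eq))
states-injective {T = other T} {other U} eq = cong other (states-injective (cong Vec.tail eq))
states-injective {T = lower T} {lower U} eq = cong lower (states-injective (cong Vec.tail eq))
states-injective {T = upper T} {upper U} eq = cong upper (states-injective (cong Vec.tail eq))
states-injective {T = base T}  {other U} ()
states-injective {T = base T}  {lower U} ()
states-injective {T = other T} {base U}  ()
states-injective {T = other T} {lower U} ()
states-injective {T = lower T} {base U}  ()
states-injective {T = lower T} {other U} ()

state-ext : ∀ {s t} → isBase s ≡ isBase t → isOther s ≡ isOther t → isLower s ≡ isLower t → s ≡ t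
state-ext {neither} {neither} _ _ _ = refl
state-ext {both}    {both}    _ _ _ = refl
state-ext {first}   {first}   _ _ _ = refl
state-ext {second}  {second}  _ _ _ = refl

matching-injective : ∀ {r} {T U : Tiling false (suc r)} → matching T ≡ matching U → T ≡ U
matching-injective {r} {T} {U} eq = states-injective (Pointwise-≡⇒≡ (ext λ y →
  let base≡ , other≡ = pick (odd (toℕ y)) (occupied≡ (hor zero y)) (occupied≡ (hor (suc zero) y))
  -- The top row has no vertical edges above it, so `isLower` is recovered through `above`, which
  -- covers all rows.
  in state-ext base≡ other≡ (trans (sym (above-isLower T y))
       (trans (above-cong (λ y′ → occupied≡ (ver zero y′)) y) (above-isLower U y)))))
  where
  true⇒ : ∀ {T U} → matching T ≡ matching U → ∀ e → occupied T e ≡ true → occupied U e ≡ true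
  true⇒ {T} {U} eq e p = proj₂ (∈-filter⁻ (λ e → occupied U e Bool.≟ true) {xs = allEdges r}
    (subst (e ∈_) eq (∈-filter⁺ (λ e → occupied T e Bool.≟ true) (∈-allEdges e) p)))
  iff : ∀ {b c} → (b ≡ true → c ≡ true) → (c ≡ true → b ≡ true) → b ≡ c
  iff {true}          f g = sym (f refl)
  iff {false} {true}  f g = g refl
  iff {false} {false} f g = refl
  occupied≡ : ∀ e → occupied T e ≡ occupied U e
  occupied≡ e = iff (true⇒ eq e) (true⇒ (sym eq) e)
  pick : ∀ o {s t} → (if o then isBase s else isOther s) ≡ (if o then isBase t else isOther t) →
    (if not o then isBase s else isOther s) ≡ (if not o then isBase t else isOther t) →
    isBase s ≡ isBase t × isOther s ≡ isOther t
  pick true  p q = p , q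
  pick false p q = q , p

∈-tilings : ∀ {p n} (T : Tiling p n) → T ∈ tilings p n
∈-tilings []        = here refl
∈-tilings (base T)  = ∈-++⁺ˡ (∈-map⁺ base (∈-tilings T))
∈-tilings (other T) = ∈-++⁺ʳ (map base (tilings false _)) (∈-++⁺ˡ (∈-map⁺ other (∈-tilings T)))
∈-tilings (lower T) = ∈-++⁺ʳ (map base (tilings false _)) (∈-++⁺ʳ (map other (tilings false _))
    (∈-map⁺ lower (∈-tilings T)))
∈-tilings (upper T) = ∈-map⁺ upper (∈-tilings T)

tilings-unique : ∀ p n → Unique (tilings p n)
tilings-unique false zero    = [] ∷ []
tilings-unique true  zero    = []
tilings-unique true  (suc n) = Unique.map⁺ (λ { refl → refl }) (tilings-unique false n)
tilings-unique false (suc n) =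
  Unique.++⁺ (Unique.map⁺ (λ { refl → refl }) (tilings-unique false n))
    (Unique.++⁺ (Unique.map⁺ (λ { refl → refl }) (tilings-unique false n))
      (Unique.map⁺ (λ { refl → refl }) (tilings-unique true n)) other-lower)
    base-rest
  where
  other-lower : Disjoint (map other (tilings false n)) (map lower (tilings true n))
  other-lower (p , q) with ∈-map⁻ other p | ∈-map⁻ lower q
  ... | _ , _ , refl | _ , _ , ()
  base-rest : Disjoint (map base (tilings false n)) (map other (tilings false n) ++ map lower (tilings true n))
  base-rest (p , q) with ∈-map⁻ base p | ∈-++⁻ (map other (tilings false n)) q
  ... | _ , _ , refl | inj₁ q′ with ∈-map⁻ other q′
  ...   | _ , _ , ()
  base-rest (p , q) | _ , _ , refl | inj₂ q′ with ∈-map⁻ lower q′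
  ...   | _ , _ , ()

-- Both lists are duplicate-free with the same members. The order differs, but only sums over them
-- are taken.
perfectMatchings-↭ : ∀ r → perfectMatchings r ↭ map matching (tilings false (suc r))
perfectMatchings-↭ r = ∼bag⇒↭ (unique∧set⇒bag
  (Unique.filter⁺ perfect? (sublists-unique (allEdges-unique r)))
  (Unique.map⁺ matching-injective (tilings-unique false (suc r)))
  (mk⇔ to from))
  where
  perfect? : ∀ (M : List (Edge r)) → _
  perfect? M = isPerfectMatching M Bool.≟ true
  to : ∀ {M} → M ∈ perfectMatchings r → M ∈ map matching (tilings false (suc r))
  to p with ∈-filter⁻ perfect? {xs = sublists (allEdges r)} p
  ... | M∈ , perfect with sublists⁻ _≟ᴱ_ (allEdges-unique r) M∈
  ...   | χ , refl = let T , eq = perfect⇒matching χ perfect in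
    subst (_∈ map matching (tilings false (suc r))) (sym eq) (∈-map⁺ matching (∈-tilings T))
  from : ∀ {M} → M ∈ map matching (tilings false (suc r)) → M ∈ perfectMatchings r
  from p with ∈-map⁻ matching p
  ... | T , _ , refl = ∈-filter⁺ perfect? (where-true∈sublists (occupied T) (allEdges r)) (matching-perfect T)

-- Weights and classes of matchings

module Σℤ = Summation ℤ.+-0-isCommutativeMonoid
module ℤEdgeSum = EdgeSum ℤ.+-0-isCommutativeMonoid

lookup-sumExps : ∀ {A : Set} {n} (f : A → Exps n) xs i →
  lookup (sumExps (map f xs)) i ≡ Σℤ.sum xs (λ x → lookup (f x) i)
lookup-sumExps f []       i = Vec.lookup-replicate i (ℤ.+ 0)
lookup-sumExps f (x ∷ xs) i = trans (Vec.lookup-zipWith ℤ._+_ i (f x) (sumExps (map f xs)))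
  (cong (λ z → lookup (f x) i ℤ.+ z) (lookup-sumExps f xs i))

lookup-edgeExp : ∀ {r} (e : Edge r) i → lookup (edgeExp e) i ≡
  ℤ.- (lookup (faceExp {r} (proj₁ (facesOf e))) i ℤ.+ lookup (faceExp {r} (proj₂ (facesOf e))) i)
lookup-edgeExp {r} e i = trans (Vec.lookup-map i ℤ.-_ (zipWith ℤ._+_ (faceExp {r} (proj₁ (facesOf e)))
    (faceExp {r} (proj₂ (facesOf e)))))
  (cong ℤ.-_ (Vec.lookup-zipWith ℤ._+_ i (faceExp {r} (proj₁ (facesOf e))) (faceExp {r} (proj₂ (facesOf e)))))

sign : Bool → ℤ
sign b = if b then ℤ.+ 1 else ℤ.+ 0

lookup-faceExp : ∀ {r} (j i : Fin (r ℕ.+ r)) → lookup (faceExp {r} (just j)) i ≡ sign (toℕ j ≡ᵇ toℕ i)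
lookup-faceExp j i = trans (Vec.lookup∘tabulate _ i) (cong sign (does-≟-≡ᵇ j i))

≡ᵇ-+ : ∀ k m n → (k ℕ.+ m ≡ᵇ k ℕ.+ n) ≡ (m ≡ᵇ n)
≡ᵇ-+ zero    m n = refl
≡ᵇ-+ (suc k) m n = ≡ᵇ-+ k m n

module _ {r : ℕ} (j a : Fin r) where

  faceExp-ˡˡ : lookup (faceExp {r} (just (j ↑ˡ r))) (a ↑ˡ r) ≡ sign (toℕ j ≡ᵇ toℕ a)
  faceExp-ˡˡ = trans (lookup-faceExp {r} (j ↑ˡ r) (a ↑ˡ r))
    (cong₂ (λ m n → sign (m ≡ᵇ n)) (Fin.toℕ-↑ˡ j r) (Fin.toℕ-↑ˡ a r))

  faceExp-ʳʳ : lookup (faceExp {r} (just (r ↑ʳ j))) (r ↑ʳ a) ≡ sign (toℕ j ≡ᵇ toℕ a)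
  faceExp-ʳʳ = trans (lookup-faceExp {r} (r ↑ʳ j) (r ↑ʳ a))
    (trans (cong₂ (λ m n → sign (m ≡ᵇ n)) (Fin.toℕ-↑ʳ r j) (Fin.toℕ-↑ʳ r a)) (cong sign (≡ᵇ-+ r (toℕ j) (toℕ a))))

  faceExp-ˡʳ : lookup (faceExp {r} (just (j ↑ˡ r))) (r ↑ʳ a) ≡ ℤ.+ 0
  faceExp-ˡʳ = trans (lookup-faceExp {r} (j ↑ˡ r) (r ↑ʳ a))
    (cong sign (dec-false (toℕ (j ↑ˡ r) ℕ.≟ toℕ (r ↑ʳ a)) λ eq → ℕ.<⇒≢ (ℕ.<-≤-trans (Fin.toℕ<n j) (ℕ.m≤m+n r (toℕ a)))
      (trans (sym (Fin.toℕ-↑ˡ j r)) (trans eq (Fin.toℕ-↑ʳ r a)))))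

  faceExp-ʳˡ : lookup (faceExp {r} (just (r ↑ʳ j))) (a ↑ˡ r) ≡ ℤ.+ 0
  faceExp-ʳˡ = trans (lookup-faceExp {r} (r ↑ʳ j) (a ↑ˡ r))
    (cong sign (dec-false (toℕ (r ↑ʳ j) ℕ.≟ toℕ (a ↑ˡ r)) λ eq → ℕ.<⇒≢ (ℕ.<-≤-trans (Fin.toℕ<n a) (ℕ.m≤m+n r (toℕ j)))
      (trans (sym (Fin.toℕ-↑ˡ a r)) (trans (sym eq) (Fin.toℕ-↑ʳ r j)))))

-- The exponent of a variable of row `k` in a cell of row `m`; `w` tells whether the column of the
-- cell carries that variable.
cellIs : ℕ → ℕ → Bool → ℤ
cellIs m k w = if m ≡ᵇ k then sign w else ℤ.+ 0

cellIs-false : ∀ m k → cellIs m k false ≡ ℤ.+ 0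
cellIs-false m k = Bool.if-eta (m ≡ᵇ k)

cellIs-at : ∀ m k (w : ℕ → Bool) → cellIs m k (w m) ≡ cellIs m k (w k)
cellIs-at m k w with m ≡ᵇ k in eq
... | true  = cong (sign ∘ w) (ℕ.≡ᵇ⇒≡ m k (subst Bool.T (sym eq) _))
... | false = refl

cellIs-≥ : ∀ {r} m (a : Fin r) w → ¬ m ℕ.< r → ℤ.+ 0 ≡ cellIs m (toℕ a) w
cellIs-≥ m a w m≮r = sym (cong (if_then sign w else ℤ.+ 0)
  (dec-false (m ℕ.≟ toℕ a) λ eq → m≮r (subst (ℕ._< _) (sym eq) (Fin.toℕ<n a))))

module _ {r : ℕ} (a : Fin r) where

  private
    at : ∀ {m} (p : m ℕ.< r) → sign (toℕ (fromℕ< p) ≡ᵇ toℕ a) ≡ cellIs m (toℕ a) true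
    at p = cong (λ k → sign (k ≡ᵇ toℕ a)) (Fin.toℕ-fromℕ< p)

    off : ∀ m → ℤ.+ 0 ≡ cellIs m (toℕ a) false
    off m = sym (cellIs-false m (toℕ a))

  -- The labels form a checkerboard: with rows counted from 0, the first half of the variables sits
  -- where column plus row is even, the second half where it is odd.
  lookup-cellˡ : ∀ c m → lookup (faceExp {r} (cell r c m)) (a ↑ˡ r) ≡ cellIs m (toℕ a) (not (odd (toℕ c ℕ.+ m)))
  lookup-cellˡ zero m with m <? r
  ... | no m≮r = trans (Vec.lookup-replicate (a ↑ˡ r) (ℤ.+ 0)) (cellIs-≥ m a (not (odd m)) m≮r)
  ... | yes p with odd m
  ...   | true  = trans (faceExp-ʳˡ (fromℕ< p) a) (off m)
  ...   | false = trans (faceExp-ˡˡ (fromℕ< p) a) (at p)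
  lookup-cellˡ (suc zero) m with m <? r
  ... | no m≮r = trans (Vec.lookup-replicate (a ↑ˡ r) (ℤ.+ 0)) (cellIs-≥ m a (not (not (odd m))) m≮r)
  ... | yes p with odd m
  ...   | true  = trans (faceExp-ˡˡ (fromℕ< p) a) (at p)
  ...   | false = trans (faceExp-ʳˡ (fromℕ< p) a) (off m)

  lookup-cellʳ : ∀ c m → lookup (faceExp {r} (cell r c m)) (r ↑ʳ a) ≡ cellIs m (toℕ a) (odd (toℕ c ℕ.+ m))
  lookup-cellʳ zero m with m <? r
  ... | no m≮r = trans (Vec.lookup-replicate (r ↑ʳ a) (ℤ.+ 0)) (cellIs-≥ m a (odd m) m≮r)
  ... | yes p with odd m
  ...   | true  = trans (faceExp-ʳʳ (fromℕ< p) a) (at p)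
  ...   | false = trans (faceExp-ˡʳ (fromℕ< p) a) (off m)
  lookup-cellʳ (suc zero) m with m <? r
  ... | no m≮r = trans (Vec.lookup-replicate (r ↑ʳ a) (ℤ.+ 0)) (cellIs-≥ m a (not (odd m)) m≮r)
  ... | yes p with odd m
  ...   | true  = trans (faceExp-ˡʳ (fromℕ< p) a) (off m)
  ...   | false = trans (faceExp-ʳʳ (fromℕ< p) a) (at p)

rowIs : Bool → Bool → ℤ
rowIs χ w = if χ then ℤ.- sign w else ℤ.+ 0

sum-cellIs : ∀ {n} (χ : Fin n → Bool) k w (y : Fin n) → toℕ y ≡ k →
  Σℤ.sumFin n (λ y′ → if χ y′ then ℤ.- cellIs (toℕ y′) k w else ℤ.+ 0) ≡ rowIs (χ y) w
sum-cellIs {n} χ k w y refl = trans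
  (Σℤ.sumFin-single y {f = λ y′ → if χ y′ then ℤ.- cellIs (toℕ y′) (toℕ y) w else ℤ.+ 0} λ y′ y′≢y →
    trans (cong (λ b → if χ y′ then ℤ.- (if b then sign w else ℤ.+ 0) else ℤ.+ 0)
             (dec-false (toℕ y′ ℕ.≟ toℕ y) (y′≢y ∘ Fin.toℕ-injective))) (Bool.if-eta (χ y′)))
  (cong (λ b → if χ y then ℤ.- (if b then sign w else ℤ.+ 0) else ℤ.+ 0) (dec-true (toℕ y ℕ.≟ toℕ y) refl))

if-neg-+ : ∀ b x y → (if b then ℤ.- (x ℤ.+ y) else ℤ.+ 0) ≡ (if b then ℤ.- x else ℤ.+ 0) ℤ.+
    (if b then ℤ.- y else ℤ.+ 0)
if-neg-+ true  x y = ℤ.neg-distrib-+ x y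
if-neg-+ false x y = refl

module _ {r : ℕ} (χ : Edge r → Bool) (i : Fin (r ℕ.+ r)) (a : Fin r) (w : Fin 2 → Bool)
  (lookup-cell : ∀ c m → lookup (faceExp {r} (cell r c m)) i ≡ cellIs m (toℕ a) (w c)) where

  private
    horizontal vertical : Fin 2 → ℤ
    horizontal c = rowIs (χ (hor c (suc a))) (w c) ℤ.+ rowIs (χ (hor c (inject₁ a))) (w c)
    vertical x = rowIs (χ (ver x a)) (w zero) ℤ.+ rowIs (χ (ver x a)) (w (suc zero))

    lookup-hor : ∀ c y → lookup (edgeExp {r} (hor c y)) i ≡
      ℤ.- (cellIs (toℕ y) (suc (toℕ a)) (w c) ℤ.+ cellIs (toℕ y) (toℕ a) (w c))
    -- Below row 0 lies the annulus of weight 1; accordingly `cellIs 0 (suc (toℕ a)) (w c)` computes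
    -- to 0.
    lookup-hor c zero = trans (lookup-edgeExp {r} (hor c zero) i)
      (cong ℤ.-_ (cong₂ ℤ._+_ (Vec.lookup-replicate i (ℤ.+ 0)) (lookup-cell c 0)))
    lookup-hor c (suc y) = trans (lookup-edgeExp {r} (hor c (suc y)) i)
      (cong ℤ.-_ (cong₂ ℤ._+_ (lookup-cell c (toℕ y)) (lookup-cell c (suc (toℕ y)))))

    horizontal-sum : ∀ c → Σℤ.sumFin (suc r) (λ y → if χ (hor c y) then lookup (edgeExp (hor c y)) i else ℤ.+ 0) ≡
        horizontal c
    horizontal-sum c = trans
      (Σℤ.sum-cong (allFin (suc r)) λ y → trans (cong (if χ (hor c y) then_else ℤ.+ 0) (lookup-hor c y))
        (if-neg-+ (χ (hor c y)) (cellIs (toℕ y) (suc (toℕ a)) (w c)) (cellIs (toℕ y) (toℕ a) (w c))))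
      (trans (Σℤ.sum-∙ (allFin (suc r)) (λ y → if χ (hor c y) then ℤ.- cellIs (toℕ y) (suc (toℕ a)) (w c) else ℤ.+ 0)
                                         (λ y → if χ (hor c y) then ℤ.- cellIs (toℕ y) (toℕ a) (w c) else ℤ.+ 0))
        (cong₂ ℤ._+_ (sum-cellIs (χ ∘ hor c) (suc (toℕ a)) (w c) (suc a) refl)
                     (sum-cellIs (χ ∘ hor c) (toℕ a) (w c) (inject₁ a) (Fin.toℕ-inject₁ a))))

    vertical-sum : ∀ x → Σℤ.sumFin r (λ y → if χ (ver x y) then lookup (edgeExp (ver x y)) i else ℤ.+ 0) ≡ vertical x
    vertical-sum x = trans
      (Σℤ.sum-cong (allFin r) λ y → trans (cong (if χ (ver x y) then_else ℤ.+ 0) (trans (lookup-edgeExp (ver x y) i)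
          (cong ℤ.-_ (cong₂ ℤ._+_ (lookup-cell zero (toℕ y)) (lookup-cell (suc zero) (toℕ y))))))
        (if-neg-+ (χ (ver x y)) (cellIs (toℕ y) (toℕ a) (w zero)) (cellIs (toℕ y) (toℕ a) (w (suc zero)))))
      (trans (Σℤ.sum-∙ (allFin r) (λ y → if χ (ver x y) then ℤ.- cellIs (toℕ y) (toℕ a) (w zero) else ℤ.+ 0)
                                   (λ y → if χ (ver x y) then ℤ.- cellIs (toℕ y) (toℕ a) (w (suc zero)) else ℤ.+ 0))
        (cong₂ ℤ._+_ (sum-cellIs (χ ∘ ver x) (toℕ a) (w zero) a refl)
                     (sum-cellIs (χ ∘ ver x) (toℕ a) (w (suc zero)) a refl)))

  -- A cell is bordered by the horizontal edges of its own column at its top and bottom, whereas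
  -- each vertical edge of the row borders both cells of the row.
  lookup-select : lookup (sumExps (map edgeExp (where-true χ (allEdges r)))) i ≡
    (horizontal zero ℤ.+ (horizontal (suc zero) ℤ.+ ℤ.+ 0)) ℤ.+ (vertical zero ℤ.+ (vertical (suc zero) ℤ.+ ℤ.+ 0))
  lookup-select = trans (lookup-sumExps edgeExp (where-true χ (allEdges r)) i)
    (trans (ℤEdgeSum.sum-select χ (λ e → lookup (edgeExp e) i))
      (cong₂ ℤ._+_ (Σℤ.sum-cong (allFin 2) horizontal-sum) (Σℤ.sum-cong (allFin 2) vertical-sum)))

-- The exponent contributed to the variable of a cell in a row of parity o, between rows in states s and s′:
-- w₀ and w₁ tell which of the two cells of the row carries this variable.
cellExp : Bool → Bool → Bool → State → State → ℤ
cellExp o w₀ w₁ s s′ =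
  ((rowIs (if not o then isBase s′ else isOther s′) w₀ ℤ.+ rowIs (if o then isBase s else isOther s) w₀) ℤ.+
   ((rowIs (if not (not o) then isBase s′ else isOther s′) w₁ ℤ.+ rowIs
       (if not o then isBase s else isOther s) w₁) ℤ.+ ℤ.+ 0)) ℤ.+
  ((rowIs (isLower s) w₀ ℤ.+ rowIs (isLower s) w₁) ℤ.+ ((rowIs (isLower s) w₀ ℤ.+ rowIs (isLower s) w₁) ℤ.+ ℤ.+ 0))

lookup-matching : ∀ {r} (T : Tiling false (suc r)) i (a : Fin r) (w : Fin 2 → Bool) →
  (∀ c m → lookup (faceExp {r} (cell r c m)) i ≡ cellIs m (toℕ a) (w c)) →
  lookup (sumExps (map edgeExp (matching T))) i ≡
  cellExp (odd (toℕ a)) (w zero) (w (suc zero)) (stateAt T (inject₁ a)) (stateAt T (suc a))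
lookup-matching {r} T i a w lookup-cell = trans (lookup-select (occupied T) i a w lookup-cell)
  (cong (λ k → ((rowIs (if not (odd (toℕ a)) then isBase s′ else isOther s′) (w zero) ℤ.+ rowIs
      (if odd k then isBase s else isOther s) (w zero)) ℤ.+
   ((rowIs (if not (not (odd (toℕ a))) then isBase s′ else isOther s′) (w (suc zero)) ℤ.+ rowIs
       (if not (odd k) then isBase s else isOther s) (w (suc zero))) ℤ.+ ℤ.+ 0)) ℤ.+
  ((rowIs (isLower s) (w zero) ℤ.+ rowIs (isLower s) (w (suc zero))) ℤ.+
      ((rowIs (isLower s) (w zero) ℤ.+ rowIs (isLower s) (w (suc zero))) ℤ.+ ℤ.+ 0)))
    (Fin.toℕ-inject₁ a))
  where
  s s′ : State
  s = stateAt T (inject₁ a)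
  s′ = stateAt T (suc a)

-- Subtracting the value at `neither` and `neither` divides by the weight of `M₀`. As `first` is
-- followed by `second` and by nothing else, and `second` preceded only by `first`, ten pairs of
-- states remain for each parity.
cellExp-start : ∀ o s s′ → isUpper s′ ≡ isLower s →
  cellExp o (not o) (not (not o)) s s′ ℤ.- cellExp o (not o) (not (not o)) neither neither ≡
      ℤ.+ start s′ ℤ.- ℤ.+ start s
cellExp-start true  neither neither _ = refl
cellExp-start true  neither both    _ = refl
cellExp-start true  neither first   _ = refl
cellExp-start true  both    neither _ = refl
cellExp-start true  both    both    _ = refl
cellExp-start true  both    first   _ = refl
cellExp-start true  first   second  _ = refl
cellExp-start true  second  neither _ = refl
cellExp-start true  second  both    _ = refl
cellExp-start true  second  first   _ = refl
cellExp-start false neither neither _ = refl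
cellExp-start false neither both    _ = refl
cellExp-start false neither first   _ = refl
cellExp-start false both    neither _ = refl
cellExp-start false both    both    _ = refl
cellExp-start false both    first   _ = refl
cellExp-start false first   second  _ = refl
cellExp-start false second  neither _ = refl
cellExp-start false second  both    _ = refl
cellExp-start false second  first   _ = refl

cellExp-stop : ∀ o s s′ → isUpper s′ ≡ isLower s →
  cellExp o o (not o) s s′ ℤ.- cellExp o o (not o) neither neither ≡ ℤ.+ stop s ℤ.- ℤ.+ stop s′
cellExp-stop true  neither neither _ = refl
cellExp-stop true  neither both    _ = refl
cellExp-stop true  neither first   _ = refl
cellExp-stop true  both    neither _ = refl
cellExp-stop true  both    both    _ = refl
cellExp-stop true  both    first   _ = refl
cellExp-stop true  first   second  _ = refl
cellExp-stop true  second  neither _ = refl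
cellExp-stop true  second  both    _ = refl
cellExp-stop true  second  first   _ = refl
cellExp-stop false neither neither _ = refl
cellExp-stop false neither both    _ = refl
cellExp-stop false neither first   _ = refl
cellExp-stop false both    neither _ = refl
cellExp-stop false both    both    _ = refl
cellExp-stop false both    first   _ = refl
cellExp-stop false first   second  _ = refl
cellExp-stop false second  neither _ = refl
cellExp-stop false second  both    _ = refl
cellExp-stop false second  first   _ = refl

allBase : ∀ n → Tiling false n
allBase zero    = []
allBase (suc n) = base (allBase n)

stateAt-allBase : ∀ {n} (y : Fin n) → stateAt (allBase n) y ≡ neither
stateAt-allBase zero    = refl
stateAt-allBase (suc y) = stateAt-allBase y

where-true-none : ∀ {A : Set} {χ : A → Bool} {xs} → All (λ x → χ x ≡ false) xs → where-true χ xs ≡ []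
where-true-none []         = refl
where-true-none {χ = χ} {x ∷ xs} (eq ∷ eqs) = trans (where-true-∷-false {χ = χ} xs eq) (where-true-none eqs)

if-true-false : ∀ b → b ≡ (if b then true else false)
if-true-false true  = refl
if-true-false false = refl

M₀≡matching : ∀ r → M₀ r ≡ matching (allBase (suc r))
M₀≡matching r = sym (trans (filter-++ (λ e → χ e Bool.≟ true) horizontals verticals)
  (trans (cong₂ _++_ (where-true-cong {χ = χ} (All.tabulate {xs = horizontals} λ {e} _ → agree e))
           (where-true-none {χ = χ} (All.tabulate {xs = verticals} λ {e} p → verticals-off e p)))
    -- leftBlack must be re-defined: the one of M₀ is local.  Row 0 of column 0 has been computed away by filter.
    (trans (++-identityʳ (where-true leftBlack horizontals))
      (where-true-cong {xs = map (hor zero) (tabulate Fin.suc) ++ (map (hor (suc zero)) (allFin (suc r)) ++ [])}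
          (All.tabulate λ { {hor c y} _ → refl ; {ver x y} _ → refl })))))
  where
  horizontals verticals : List (Edge r)
  horizontals = concatMap (λ c → map (hor c) (allFin (suc r))) (allFin 2)
  verticals = concatMap (λ x → map (ver x) (allFin r)) (allFin 2)
  χ : Edge r → Bool
  χ = occupied (allBase (suc r))
  leftBlack : Edge r → Bool
  leftBlack (hor c y) = black (c , y)
  leftBlack (ver _ _) = false
  agree : ∀ e → χ e ≡ leftBlack e
  agree (hor c y) = trans (cong (λ s → if black (c , y) then isBase s else isOther s) (stateAt-allBase y))
    (sym (if-true-false (black (c , y))))
  agree (ver x y) = cong isLower (stateAt-allBase (inject₁ y))
  verticals-off : ∀ e → e ∈ verticals → χ e ≡ false
  verticals-off (ver x y) p = cong isLower (stateAt-allBase (inject₁ y))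
  verticals-off (hor c y) p with ∈-++⁻ (map (ver zero) (allFin r)) p
  ... | inj₁ q = ⊥-elim (hor∉vers zero _ q)
  ... | inj₂ q with ∈-++⁻ (map (ver (suc zero)) (allFin r)) q
  ...   | inj₁ q′ = ⊥-elim (hor∉vers (suc zero) _ q′)

relWeightExp-matching : ∀ {r} (T : Tiling false (suc r)) → relWeightExp (matching T) ≡ tilingExponents T
relWeightExp-matching {r} T = halves-ext (relWeightExp (matching T)) (tilingExponents T)
  (λ a → trans (difference (a ↑ˡ r) a (λ c → not (odd (toℕ c ℕ.+ toℕ a)))
      (λ c m → trans (lookup-cellˡ a c m) (cellIs-at m (toℕ a) (λ k → not (odd (toℕ c ℕ.+ k))))))
    (trans (cellExp-start (odd (toℕ a)) (stateAt T (inject₁ a)) (stateAt T (suc a)) (isUpper-suc T a))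
      (sym (lookup-exponentsˡ (start ∘ stateAt T) (stop ∘ stateAt T) a))))
  (λ a → trans (difference (r ↑ʳ a) a (λ c → odd (toℕ c ℕ.+ toℕ a))
      (λ c m → trans (lookup-cellʳ a c m) (cellIs-at m (toℕ a) (λ k → odd (toℕ c ℕ.+ k)))))
    (trans (cellExp-stop (odd (toℕ a)) (stateAt T (inject₁ a)) (stateAt T (suc a)) (isUpper-suc T a))
      (sym (lookup-exponentsʳ (start ∘ stateAt T) (stop ∘ stateAt T) a))))
  where
  difference : ∀ i (a : Fin r) (w : Fin 2 → Bool) →
    (∀ c m → lookup (faceExp {r} (cell r c m)) i ≡ cellIs m (toℕ a) (w c)) →
    lookup (relWeightExp (matching T)) i ≡
    cellExp (odd (toℕ a)) (w zero) (w (suc zero)) (stateAt T (inject₁ a)) (stateAt T (suc a)) ℤ.-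
    cellExp (odd (toℕ a)) (w zero) (w (suc zero)) neither neither
  difference i a w lookup-cell = trans
    (Vec.lookup-zipWith ℤ._-_ i (sumExps (map edgeExp (matching T))) (sumExps (map edgeExp (M₀ r))))
    (cong₂ ℤ._-_ (lookup-matching T i a w lookup-cell)
      (trans (cong (λ M → lookup (sumExps (map edgeExp M)) i) (M₀≡matching r))
        (trans (lookup-matching (allBase (suc r)) i a w lookup-cell)
          (cong₂ (cellExp (odd (toℕ a)) (w zero) (w (suc zero)))
            (stateAt-allBase (inject₁ a)) (stateAt-allBase (suc a))))))

-- Homology classes of matchings

elem⁺ : ∀ {r} (e : Edge r) {M} → e ∈ M → elem e M ≡ true
elem⁺ e (here refl) rewrite edgeEq-refl e = refl
elem⁺ e {e′ ∷ M} (there p) rewrite elem⁺ e p = Bool.∨-zeroʳ (edgeEq e e′)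

elem⁻ : ∀ {r} (e : Edge r) {M} → elem e M ≡ true → e ∈ M
elem⁻ e {e′ ∷ M} eq with edgeEq e e′ in e≡e′
... | true  = here (edgeEq⇒≡ e e′ e≡e′)
... | false = there (elem⁻ e eq)

elem-select : ∀ {r} (χ : Edge r → Bool) e → elem e (where-true χ (allEdges r)) ≡ χ e
elem-select {r} χ e with elem e (where-true χ (allEdges r)) in eq | χ e in χe
... | true  | true  = refl
... | false | false = refl
... | true  | false = trans (sym (proj₂ (∈-filter⁻ (λ e → χ e Bool.≟ true) {xs = allEdges r} (elem⁻ e eq)))) χe
... | false | true  = trans (sym eq) (elem⁺ e (∈-filter⁺ (λ e → χ e Bool.≟ true) (∈-allEdges e) χe))

classWith-select : ∀ {r} (cr : Edge r → ℤ) (χ χ₀ : Edge r → Bool) → M₀ r ≡ where-true χ₀ (allEdges r) →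
  classWith cr (where-true χ (allEdges r)) ≡
  Σℤ.sum (where-true χ (allEdges r)) (λ e → if χ₀ e then ℤ.+ 0 else cr e) ℤ.-
  Σℤ.sum (where-true χ₀ (allEdges r)) (λ e → if χ e then ℤ.+ 0 else cr e)
classWith-select {r} cr χ χ₀ M₀≡ = cong₂ ℤ._-_
  (trans (Σℤ.sum-filter-not (λ e → elem e (M₀ r)) (where-true χ (allEdges r)) cr)
    (Σℤ.sum-cong (where-true χ (allEdges r)) λ e → cong (if_then ℤ.+ 0 else cr e)
      (trans (cong (elem e) M₀≡) (elem-select χ₀ e))))
  (trans (cong (λ M → Σℤ.sum (filter (λ e → elem e (where-true χ (allEdges r)) Bool.≟ false) M) cr) M₀≡)
    (trans (Σℤ.sum-filter-not (λ e → elem e (where-true χ (allEdges r))) (where-true χ₀ (allEdges r)) cr)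
      (Σℤ.sum-cong (where-true χ₀ (allEdges r)) λ e → cong (if_then ℤ.+ 0 else cr e) (elem-select χ e))))

-- The parity of the row `k` steps above a row of parity `o`; the free `o` lets an induction strip
-- bottom rows.
parity : Bool → ℕ → Bool
parity o k = if odd k then not o else o

parity-suc : ∀ o k → parity o (suc k) ≡ parity (not o) k
parity-suc o k with odd k
... | true  = sym (Bool.not-involutive o)
... | false = refl

-- Every crossing of x = 1/2 counts positively. In odd rows the edge of column 0 belongs to `M₀` and
-- is traversed backwards when the matching lacks it; in even rows it is the companion edge,
-- traversed forwards when present.
rowCrossing : Bool → State → ℤ
rowCrossing true  s = if isBase s then ℤ.+ 0 else ℤ.+ 1
rowCrossing false s = if isOther s then ℤ.+ 1 else ℤ.+ 0

-- Relative to M₀, a pair of vertical edges crosses x = 1/2 only in its odd row: there it lacks the edge of M₀.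
sum-rowCrossing : ∀ {p n} (T : Tiling p n) o →
  Σℤ.sumFin n (λ y → rowCrossing (parity o (toℕ y)) (stateAt T y)) ≡ ℤ.+ starts (states T) ℤ.+ sign (p ∧ o)
sum-rowCrossing-∷ : ∀ {p n} s (T : Tiling p n) o →
  Σℤ.sumFin (suc n) (λ y → rowCrossing (parity o (toℕ y)) (lookup (s ∷ states T) y)) ≡
  rowCrossing o s ℤ.+ (ℤ.+ starts (states T) ℤ.+ sign (p ∧ not o))
sum-rowCrossing-∷ {n = n} s T o = trans (Σℤ.sumFin-suc (λ y → rowCrossing (parity o (toℕ y))
    (lookup (s ∷ states T) y)))
  (cong (λ z → rowCrossing o s ℤ.+ z) (trans
    (Σℤ.sum-cong (allFin n) λ y → cong (λ b → rowCrossing b (stateAt T y)) (parity-suc o (toℕ y)))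
    (sum-rowCrossing T (not o))))

sum-rowCrossing []        o     = refl
sum-rowCrossing (base T)  true  = trans (sum-rowCrossing-∷ neither T true) (ℤ.+-identityˡ _)
sum-rowCrossing (base T)  false = trans (sum-rowCrossing-∷ neither T false) (ℤ.+-identityˡ _)
sum-rowCrossing (other T) true  = trans (sum-rowCrossing-∷ both T true)
    (sym (ℤ.+-assoc (ℤ.+ 1) (ℤ.+ starts (states T)) (ℤ.+ 0)))
sum-rowCrossing (other T) false = trans (sum-rowCrossing-∷ both T false)
    (sym (ℤ.+-assoc (ℤ.+ 1) (ℤ.+ starts (states T)) (ℤ.+ 0)))
sum-rowCrossing (lower T) true  = trans (sum-rowCrossing-∷ first T true)
    (sym (ℤ.+-assoc (ℤ.+ 1) (ℤ.+ starts (states T)) (ℤ.+ 0)))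
sum-rowCrossing (lower T) false = trans (sum-rowCrossing-∷ first T false)
  (solve 1 (λ x → con (ℤ.+ 0) :+ (x :+ con (ℤ.+ 1)) := (con (ℤ.+ 1) :+ x) :+ con (ℤ.+ 0)) refl
      (ℤ.+ starts (states T)))
  where open ℤSolver.+-*-Solver
sum-rowCrossing (upper T) true  = trans (sum-rowCrossing-∷ second T true)
  (solve 1 (λ x → con (ℤ.+ 1) :+ (x :+ con (ℤ.+ 0)) := x :+ con (ℤ.+ 1)) refl (ℤ.+ starts (states T)))
  where open ℤSolver.+-*-Solver
sum-rowCrossing (upper T) false = trans (sum-rowCrossing-∷ second T false) (ℤ.+-identityˡ _)

classX-matching : ∀ {r} (T : Tiling false (suc r)) → classWith crossX-bw (matching T) ≡ ℤ.+ starts (states T)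
classX-matching {r} T = begin
  classWith crossX-bw (matching T)
    ≡⟨ classWith-select crossX-bw χ χ₀ (M₀≡matching r) ⟩
  Σℤ.sum (matching T) (λ e → if χ₀ e then ℤ.+ 0 else crossX-bw e) ℤ.-
  Σℤ.sum (matching (allBase (suc r))) (λ e → if χ e then ℤ.+ 0 else crossX-bw e)
    ≡⟨ cong₂ ℤ._-_ (only-column-0 χ χ₀) (only-column-0 χ₀ χ) ⟩
  Σℤ.sumFin (suc r) (crossings χ χ₀) ℤ.- Σℤ.sumFin (suc r) (crossings χ₀ χ)
    -- In each row the crossings of the matching equal `rowCrossing` plus those of `M₀`, so the
    -- subtracted sum cancels.
    ≡⟨ cong (ℤ._- Σℤ.sumFin (suc r) (crossings χ₀ χ)) (trans
         (Σℤ.sum-cong (allFin (suc r)) λ y → rearrange (odd (toℕ y)) (stateAt T y) (stateAt-allBase y))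
         (Σℤ.sum-∙ (allFin (suc r)) (λ y → rowCrossing (parity false (toℕ y)) (stateAt T y)) (crossings χ₀ χ))) ⟩
  (Σℤ.sumFin (suc r) (λ y → rowCrossing (parity false (toℕ y)) (stateAt T y)) ℤ.+ Σℤ.sumFin (suc r)
      (crossings χ₀ χ)) ℤ.-
    Σℤ.sumFin (suc r) (crossings χ₀ χ)
    ≡⟨ cong (λ z → (z ℤ.+ Σℤ.sumFin (suc r) (crossings χ₀ χ)) ℤ.- Σℤ.sumFin (suc r) (crossings χ₀ χ))
        (sum-rowCrossing T false) ⟩
  ((ℤ.+ starts (states T) ℤ.+ ℤ.+ 0) ℤ.+ Σℤ.sumFin (suc r) (crossings χ₀ χ)) ℤ.- Σℤ.sumFin (suc r) (crossings χ₀ χ)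
    ≡⟨ solve 2 (λ x y → ((x :+ con (ℤ.+ 0)) :+ y) :- y := x) refl (ℤ.+ starts (states T))
        (Σℤ.sumFin (suc r) (crossings χ₀ χ)) ⟩
  ℤ.+ starts (states T) ∎
  where
  open ≡-Reasoning
  open ℤSolver.+-*-Solver
  χ χ₀ : Edge r → Bool
  χ = occupied T
  χ₀ = occupied (allBase (suc r))
  crossings : (Edge r → Bool) → (Edge r → Bool) → Fin (suc r) → ℤ
  crossings ψ ψ₀ y = if ψ (hor zero y) then (if ψ₀ (hor zero y) then ℤ.+ 0 else crossX-bw {r} (hor zero y)) else ℤ.+ 0
  off : ∀ b c → (if b then (if c then ℤ.+ 0 else ℤ.+ 0) else ℤ.+ 0) ≡ ℤ.+ 0
  off true  c = Bool.if-eta c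
  off false c = refl
  only-column-0 : ∀ ψ ψ₀ → Σℤ.sum (where-true ψ (allEdges r)) (λ e → if ψ₀ e then ℤ.+ 0 else crossX-bw e) ≡
    Σℤ.sumFin (suc r) (crossings ψ ψ₀)
  only-column-0 ψ ψ₀ = trans (ℤEdgeSum.sum-select ψ (λ e → if ψ₀ e then ℤ.+ 0 else crossX-bw e))
    (trans (cong₂ ℤ._+_
      (cong (λ z → Σℤ.sumFin (suc r) (crossings ψ ψ₀) ℤ.+ (z ℤ.+ ℤ.+ 0))
        (Σℤ.sum-ε (allFin (suc r)) λ y → off (ψ (hor (suc zero) y)) (ψ₀ (hor (suc zero) y))))
      (Σℤ.sum-ε (allFin 2) λ x → Σℤ.sum-ε (allFin r) λ y → off (ψ (ver x y)) (ψ₀ (ver x y))))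
      (trans (ℤ.+-identityʳ _) (ℤ.+-identityʳ _)))
  rearrange : ∀ o s {s₀} → s₀ ≡ neither →
    (if (if o then isBase s else isOther s) then
      (if (if o then isBase s₀ else isOther s₀) then ℤ.+ 0 else (if o then ℤ.-[1+ 0 ] else ℤ.+ 1)) else ℤ.+ 0) ≡
    rowCrossing (if o then true else false) s ℤ.+
    (if (if o then isBase s₀ else isOther s₀) then
      (if (if o then isBase s else isOther s) then ℤ.+ 0 else (if o then ℤ.-[1+ 0 ] else ℤ.+ 1)) else ℤ.+ 0)
  rearrange true  neither refl = refl
  rearrange true  both    refl = refl
  rearrange true  first   refl = refl
  rearrange true  second  refl = refl
  rearrange false neither refl = refl
  rearrange false both    refl = refl
  rearrange false first   refl = refl
  rearrange false second  refl = refl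

classY-matching : ∀ {r} (T : Tiling false (suc r)) → classWith crossY-bw (matching T) ≡ ℤ.+ 0
classY-matching {r} T = trans
  (classWith-select crossY-bw (occupied T) (occupied (allBase (suc r))) (M₀≡matching r))
  (cong₂ ℤ._-_ (Σℤ.sum-ε (matching T) λ e → Bool.if-eta (occupied (allBase (suc r)) e))
               (Σℤ.sum-ε (matching (allBase (suc r))) λ e → Bool.if-eta (occupied T e)))

hasClass-matching : ∀ {r} k (T : Tiling false (suc r)) →
  hasClass k (matching T) ≡ does (ℤ.+ starts (states T) ℤ.≟ k)
hasClass-matching k T = trans
  (cong₂ (λ x y → does (x ℤ.≟ k) ∧ does (y ℤ.≟ ℤ.+ 0)) (classX-matching T) (classY-matching T)) (Bool.∧-identityʳ _)

-- Brackets

_≟ᵉ_ : ∀ {n} (u v : Exps n) → Dec (u ≡ v)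
_≟ᵉ_ = Vec.≡-dec ℤ._≟_

termCoeff : ∀ {n} → Exps n → ℚ × Exps n → ℚ
termCoeff e (c , u) = if does (u ≟ᵉ e) then c else 0ℚ

coeff-sum : ∀ {n} (p : Poly n) e → coeff p e ≡ Σℚ.sum p (termCoeff e)
coeff-sum []            e = refl
coeff-sum ((c , u) ∷ p) e with u ≟ᵉ e
... | yes _ = cong (c +_) (coeff-sum p e)
... | no _  = trans (coeff-sum p e) (sym (ℚ.+-identityˡ _))

module _ {n : ℕ} {A B : Set} (Ω : Fin n → Fin n → ℚ) (u : A → Exps n) (v : B → Exps n) (xs : List A)
    (ys : List B) where

  private
    f g : Poly n
    f = map (λ x → (1ℚ , u x)) xs
    g = map (λ y → (1ℚ , v y)) ys

    F : Exps n → Fin n → Fin n → A → B → ℚ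
    F e i j x y = termCoeff e
      (Ω i j * ((fromℤ (lookup (u x) i) * 1ℚ) * (fromℤ (lookup (v y) j) * 1ℚ)) , zipWith ℤ._+_ (u x) (v y))

    sum-mul : ∀ i j (h : ℚ × Exps n → ℚ) → Σℚ.sum (mul (θ i f) (θ j g)) h ≡
      Σℚ.sum xs λ x → Σℚ.sum ys λ y →
        h ((fromℤ (lookup (u x) i) * 1ℚ) * (fromℤ (lookup (v y) j) * 1ℚ) , zipWith ℤ._+_ (u x) (v y))
    sum-mul i j h = trans (Σℚ.sum-concatMap _ (θ i f) h) (trans (Σℚ.sum-map _ f _) (trans (Σℚ.sum-map _ xs _)
      (Σℚ.sum-cong xs λ x → trans (Σℚ.sum-map _ (θ j g) h) (trans (Σℚ.sum-map _ g _) (Σℚ.sum-map _ ys _)))))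

    collect : ∀ e x y → Σℚ.sumFin n (λ i → Σℚ.sumFin n λ j → F e i j x y) ≡
      form Ω (u x) (v y) * (if does (zipWith ℤ._+_ (u x) (v y) ≟ᵉ e) then 1ℚ else 0ℚ)
    collect e x y with does (zipWith ℤ._+_ (u x) (v y) ≟ᵉ e)
    ... | true  = trans (Σℚ.sum-cong (allFin n) λ i → Σℚ.sum-cong (allFin n) λ j →
                    cong₂ (λ a b → Ω i j * (a * b)) (ℚ.*-identityʳ (fromℤ (lookup (u x) i)))
                        (ℚ.*-identityʳ (fromℤ (lookup (v y) j))))
                    (sym (ℚ.*-identityʳ (form Ω (u x) (v y))))
    ... | false = trans (Σℚ.sum-ε (allFin n) λ i → Σℚ.sum-ε (allFin n) λ j → refl)
        (sym (ℚ.*-zeroʳ (form Ω (u x) (v y))))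

  -- Bilinearity reduces this to monomials: each Euler derivative multiplies a monomial by one of
  -- its exponents, so the bracket of the monomials with exponents u and v is their product times
  -- `form Ω u v`.
  coeff-bracket : ∀ e → coeff (bracket Ω f g) e ≡
    Σℚ.sum xs λ x → Σℚ.sum ys λ y →
      form Ω (u x) (v y) * (if does (zipWith ℤ._+_ (u x) (v y) ≟ᵉ e) then 1ℚ else 0ℚ)
  coeff-bracket e = begin
    coeff (bracket Ω f g) e
      ≡⟨ coeff-sum (bracket Ω f g) e ⟩
    Σℚ.sum (bracket Ω f g) (termCoeff e)
      ≡⟨ Σℚ.sum-concatMap _ is (termCoeff e) ⟩
    _ ≡⟨ Σℚ.sum-cong is (λ i → trans (Σℚ.sum-concatMap _ is (termCoeff e)) (Σℚ.sum-cong is λ j →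
           trans (Σℚ.sum-map _ (mul (θ i f) (θ j g)) (termCoeff e)) (sum-mul i j _))) ⟩
    Σℚ.sum is (λ i → Σℚ.sum is λ j → Σℚ.sum xs λ x → Σℚ.sum ys λ y → F e i j x y)
      ≡⟨ Σℚ.sum-cong is (λ i → trans (Σℚ.sum-swap is xs λ j x → Σℚ.sum ys λ y → F e i j x y)
           (Σℚ.sum-cong xs λ x → Σℚ.sum-swap is ys λ j y → F e i j x y)) ⟩
    Σℚ.sum is (λ i → Σℚ.sum xs λ x → Σℚ.sum ys λ y → Σℚ.sum is λ j → F e i j x y)
      ≡⟨ trans (Σℚ.sum-swap is xs λ i x → Σℚ.sum ys λ y → Σℚ.sum is λ j → F e i j x y)
           (Σℚ.sum-cong xs λ x → Σℚ.sum-swap is ys λ i y → Σℚ.sum is λ j → F e i j x y) ⟩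
    Σℚ.sum xs (λ x → Σℚ.sum ys λ y → Σℚ.sum is λ i → Σℚ.sum is λ j → F e i j x y)
      ≡⟨ Σℚ.sum-cong xs (λ x → Σℚ.sum-cong ys λ y → collect e x y) ⟩
    _ ∎
    where
    open ≡-Reasoning
    is : List (Fin n)
    is = allFin n

sum-matchings : ∀ r k (h : List (Edge r) → ℚ) →
  Σℚ.sum (where-true (hasClass k) (perfectMatchings r)) h ≡
  Σℚ.sum (tilings false (suc r)) (λ T → if does (ℤ.+ starts (states T) ℤ.≟ k) then h (matching T) else 0ℚ)
sum-matchings r k h = trans (Σℚ.sum-filter (hasClass k) (perfectMatchings r) h)
  (trans (Σℚ.sum-↭ (λ M → if hasClass k M then h M else 0ℚ) (perfectMatchings-↭ r))
    (trans (Σℚ.sum-map matching (tilings false (suc r)) (λ M → if hasClass k M then h M else 0ℚ))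
      (Σℚ.sum-cong (tilings false (suc r)) λ T → cong (if_then h (matching T) else 0ℚ) (hasClass-matching k T))))

exponents-cong : ∀ {r} {e e′ f f′ : Fin (suc r) → ℕ} → (∀ y → e y ≡ e′ y) → (∀ y → f y ≡ f′ y) →
  exponents e f ≡ exponents e′ f′
exponents-cong {e = e} {e′} {f} {f′} e≡ f≡ = halves-ext _ _
  (λ a → trans (lookup-exponentsˡ e f a) (trans (cong₂ (λ x y → ℤ.+ x ℤ.- ℤ.+ y) (e≡ (suc a)) (e≡ (inject₁ a)))
    (sym (lookup-exponentsˡ e′ f′ a))))
  (λ b → trans (lookup-exponentsʳ e f b) (trans (cong₂ (λ x y → ℤ.+ x ℤ.- ℤ.+ y) (f≡ (inject₁ b)) (f≡ (suc b)))
    (sym (lookup-exponentsʳ e′ f′ b))))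

profileExponents : ∀ {r} → Profile (suc r) → Exps (r ℕ.+ r)
profileExponents P = exponents (proj₁ ∘ lookup P) (proj₂ ∘ lookup P)

tilingExponents-+ : ∀ {r} (T U : Tiling false (suc r)) →
  zipWith ℤ._+_ (tilingExponents T) (tilingExponents U) ≡ profileExponents (profile (states T) (states U))
tilingExponents-+ T U = trans
  (exponents-+ (start ∘ stateAt T) (stop ∘ stateAt T) (start ∘ stateAt U) (stop ∘ stateAt U))
  (exponents-cong (λ y → cong proj₁ (sym (at y))) (λ y → cong proj₂ (sym (at y))))
  where
  at : ∀ y → lookup (profile (states T) (states U)) y ≡
    (start (stateAt T y) ℕ.+ start (stateAt U y) , stop (stateAt T y) ℕ.+ stop (stateAt U y))
  at y = Vec.lookup-zipWith _ y (states T) (states U)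

open import Data.Integer using (+_)

theorem5p11 : (r : ℕ) → 1 ≤ r → (X : Fin r → Fin r → ℚ) → IsCartanInverse r X →
    (m n : ℕ) → 1 ≤ m → m ≤ r → 1 ≤ n → n ≤ r →
    IsZero (bracket (Omega r X) (H r (+ m)) (H r (+ n)))
theorem5p11 (suc r) _ X inverse m n _ _ _ _ e = begin
  coeff (bracket Ω (H (suc r) (+ m)) (H (suc r) (+ n))) e
    ≡⟨ coeff-bracket Ω relWeightExp relWeightExp (classes m) (classes n) e ⟩
  Σℚ.sum (classes m) (λ M → Σℚ.sum (classes n) λ N → h M N)
    ≡⟨ sum-matchings (suc r) (+ m) (λ M → Σℚ.sum (classes n) λ N → h M N) ⟩
  Σℚ.sum Ts (λ T → if hasStarts m T then Σℚ.sum (classes n) (h (matching T)) else 0ℚ)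
    ≡⟨ Σℚ.sum-cong Ts (λ T → trans (cong (if hasStarts m T then_else 0ℚ)
        (sum-matchings (suc r) (+ n) (h (matching T))))
         (trans (if-sum (hasStarts m T) λ U → if hasStarts n U then h (matching T) (matching U) else 0ℚ)
           (Σℚ.sum-cong Ts λ U → evaluate T U))) ⟩
  crossTotal false false G
    ≡⟨ crossTotal-ff (suc (suc r)) G ⟩
  0ℚ ∎
  where
  open ≡-Reasoning
  Ω : Fin (suc r ℕ.+ suc r) → Fin (suc r ℕ.+ suc r) → ℚ
  Ω = Omega (suc r) X
  classes : ℕ → List (List (Edge (suc r)))
  classes k = where-true (hasClass (+ k)) (perfectMatchings (suc r))
  Ts : List (Tiling false (suc (suc r)))
  Ts = tilings false (suc (suc r))
  hasStarts : ℕ → Tiling false (suc (suc r)) → Bool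
  hasStarts k T = does (+ starts (states T) ℤ.≟ + k)
  h : List (Edge (suc r)) → List (Edge (suc r)) → ℚ
  h M N = form Ω (relWeightExp M) (relWeightExp N) *
    (if does (zipWith ℤ._+_ (relWeightExp M) (relWeightExp N) ≟ᵉ e) then 1ℚ else 0ℚ)
  -- The indicator of classes `m` and `n` and of the product monomial with exponent `e`. The
  -- monomial is a function of the profile, so this is a weight and `crossTotal-ff` applies.
  G : Weight (suc (suc r))
  G k l P = if does (+ k ℤ.≟ + m) then (if does (+ l ℤ.≟ + n) then
    (if does (profileExponents P ≟ᵉ e) then 1ℚ else 0ℚ) else 0ℚ) else 0ℚ
  if-sum : ∀ b (f : Tiling false (suc (suc r)) → ℚ) →
    (if b then Σℚ.sum Ts f else 0ℚ) ≡ Σℚ.sum Ts (λ U → if b then f U else 0ℚ)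
  if-sum true  f = refl
  if-sum false f = sym (Σℚ.sum-ε Ts λ _ → refl)
  if-* : ∀ b (x y : ℚ) → (if b then x * y else 0ℚ) ≡ x * (if b then y else 0ℚ)
  if-* true  x y = refl
  if-* false x y = sym (ℚ.*-zeroʳ x)
  h-matching : ∀ T U → h (matching T) (matching U) ≡ cross (states T) (states U) *
    (if does (profileExponents (profile (states T) (states U)) ≟ᵉ e) then 1ℚ else 0ℚ)
  h-matching T U = trans
    (cong₂ (λ u v → form Ω u v * (if does (zipWith ℤ._+_ u v ≟ᵉ e) then 1ℚ else 0ℚ))
      (relWeightExp-matching T) (relWeightExp-matching U))
    (cong₂ (λ x w → x * (if does (w ≟ᵉ e) then 1ℚ else 0ℚ)) (form-tilings inverse T U) (tilingExponents-+ T U))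
  evaluate : ∀ T U →
    (if hasStarts m T then (if hasStarts n U then h (matching T) (matching U) else 0ℚ) else 0ℚ) ≡
    cross (states T) (states U) * weigh G T U
  evaluate T U = trans
    (cong (if hasStarts m T then_else 0ℚ) (trans (cong (if hasStarts n U then_else 0ℚ) (h-matching T U))
      (if-* (hasStarts n U) (cross (states T) (states U)) _)))
    (if-* (hasStarts m T) (cross (states T) (states U)) _)
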